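{- For every tree $T$ of order $n\geq 3$, there is a graph $H$, obtained from $T$ by joining two distinct, nonadjacent vertices of $T$ by an edge, such that $\mu(H)>\mu(T)$.
   Context: Graphs are finite, loopless, and have no multiple edges; the order of a graph is its number of vertices. A subtree of a graph $G$ is a (not necessarily induced) subgraph of $G$ that is a tree; the null graph (with no vertices) is not counted as a subtree, while single vertices are. Let $\mathcal{T}_G$ be the set of subtrees of $G$ and $S_G(x)=\sum_{T\in\mathcal{T}_G}x^{|V(T)|}$. The mean subtree order of $G$ is the average order of a subtree of $G$, that is, $\mu(G)=S_G'(1)/S_G(1)$. -}

module Defs where

open import Data.Bool.Base using (true; false)
open import Data.Fin.Base using (Fin; zero; suc)
open import Data.Fin.Properties using (any?; all?; injective⇒≤) renaming (_≟_ to _≟ᶠ_)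
open import Data.Fin.Subset using (Subset; ⊤; ⁅_⁆; _∈_; ∣_∣; Nonempty)
  renaming (⊥ to ∅)
open import Data.Fin.Subset.Properties
  using (_∈?_; nonempty?; ∈⊤; ∉⊥; x∈⁅x⁆; x∈⁅y⁆⇒x≡y)
open import Data.Integer.Base using (+_)
open import Data.List.Base as List
  using (List; []; _∷_; [_]; _∷ʳ_; map; filter; foldr; length;
         replicate; cartesianProduct; cartesianProductWith)
open import Data.List.Membership.Propositional using () renaming (_∈_ to _∈ᴸ_)
open import Data.List.Membership.Propositional.Properties
  using (∈-filter⁺; ∈-filter⁻; ∈-cartesianProduct⁺; ∈-cartesianProductWith⁺; ∈-lookup; ∈-allFin)
open import Data.List.Relation.Unary.All using ([]; _∷_)
import Data.List.Relation.Unary.All as All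
open import Data.List.Relation.Unary.AllPairs using ([]; _∷_)
open import Data.List.Relation.Unary.Any using (here; there)
open import Data.List.Relation.Unary.Linked using (Linked; _∷_; linked?)
open import Data.List.Relation.Unary.Unique.Propositional using (Unique)
open import Data.List.Relation.Unary.Unique.Propositional.Properties
  using (filter⁺; cartesianProduct⁺; cartesianProductWith⁺)
import Data.List.Relation.Unary.Unique.DecPropositional as DecUnique
open import Data.Nat.Base
  using (ℕ; zero; suc; _+_; _*_; _≤_; z≤n; s≤s; NonZero)
open import Data.Nat.ListAction using (sum)
open import Data.Nat.Properties using (_≤?_; ≤-trans; n≤1+n; +-identityʳ)
open import Data.Nat.Solver using (module +-*-Solver)
open import Data.Product.Base using (∃; _×_; _,_; proj₁; proj₂)
open import Data.Rational.Base using (ℚ; _/_)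
open import Data.Sum.Base using (_⊎_; inj₁; inj₂)
open import Data.Vec.Base as Vec using (Vec; []; _∷_; lookup; tabulate)
open import Data.Vec.Properties
  using (lookup∘tabulate; []=⇒lookup; lookup⇒[]=; ∷-injective; lookup-replicate)
open import Function.Base using (_∘_)
open import Relation.Binary.Construct.Closure.ReflexiveTransitive
  using (Star; ε; _◅_; _◅◅_)
open import Relation.Binary.Core using (Rel)
import Relation.Binary.Definitions as B
open import Relation.Binary.PropositionalEquality
  using (_≡_; _≢_; refl; sym; trans; cong; cong₂; subst)
open import Relation.Nullary using (¬_; Dec; yes; no; does; contradiction)
open import Relation.Nullary.Decidable
  using (map′; _×-dec_; _⊎-dec_; _→-dec_; ¬?; dec-true)
open import Relation.Unary using (Pred; Decidable)
open import Level using (0ℓ)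

private
  variable
    n : ℕ

-- A set of ordered pairs of vertices, stored as a Boolean adjacency matrix so
-- that extensionally equal sets are propositionally equal.

Edges : ℕ → Set
Edges n = Vec (Subset n) n

Adj : Edges n → Rel (Fin n) 0ℓ
Adj E u v = v ∈ lookup E u

adj? : (E : Edges n) → B.Decidable (Adj E)
adj? E u v = v ∈? lookup E u

record IsGraph (V : Subset n) (E : Edges n) : Set where
  constructor isGraph
  field
    symmetric   : ∀ {u v} → Adj E u v → Adj E v u
    irreflexive : ∀ {u} → ¬ Adj E u u
    endpoint    : ∀ {u v} → Adj E u v → u ∈ V

record Graph (n : ℕ) : Set where
  constructor graph
  field
    edges    : Edges n
    isGraph⊤ : IsGraph ⊤ edges

open Graph public

infix 4 _~[_]_

_~[_]_ : Fin n → Graph n → Fin n → Set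
u ~[ G ] v = Adj (edges G) u v

fromDec : {R : Rel (Fin n) 0ℓ} → B.Decidable R → Edges n
fromDec R? = tabulate λ u → tabulate λ v → does (R? u v)

module _ {R : Rel (Fin n) 0ℓ} (R? : B.Decidable R) where

  private
    entry : ∀ u v → lookup (lookup (fromDec R?) u) v ≡ does (R? u v)
    entry u v = trans
      (cong (λ row → lookup row v) (lookup∘tabulate _ u))
      (lookup∘tabulate _ v)

  fromDec⁺ : ∀ {u v} → R u v → Adj (fromDec R?) u v
  fromDec⁺ {u} {v} r = lookup⇒[]= v _ (trans (entry u v) (dec-true (R? u v) r))

  fromDec⁻ : ∀ {u v} → Adj (fromDec R?) u v → R u v
  fromDec⁻ {u} {v} a
    with R? u v | trans (sym (entry u v)) ([]=⇒lookup a)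
  ... | yes r | _  = r
  ... | no  _ | ()

module _ (G : Graph n) {a b : Fin n} (a≢b : a ≢ b) where

  JoinAdj : Rel (Fin n) 0ℓ
  JoinAdj u v = (u ~[ G ] v) ⊎ ((u ≡ a × v ≡ b) ⊎ (u ≡ b × v ≡ a))

  joinAdj? : B.Decidable JoinAdj
  joinAdj? u v = adj? (edges G) u v ⊎-dec
    (((u ≟ᶠ a) ×-dec (v ≟ᶠ b)) ⊎-dec ((u ≟ᶠ b) ×-dec (v ≟ᶠ a)))

  join : Graph n
  join = graph (fromDec joinAdj?) (isGraph
    (λ e → fromDec⁺ joinAdj? (symJ (fromDec⁻ joinAdj? e)))
    (λ e → irrJ (fromDec⁻ joinAdj? e))
    (λ _ → ∈⊤))
    where
    open IsGraph (isGraph⊤ G)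

    symJ : ∀ {u v} → JoinAdj u v → JoinAdj v u
    symJ (inj₁ e)               = inj₁ (symmetric e)
    symJ (inj₂ (inj₁ (p , q)))  = inj₂ (inj₂ (q , p))
    symJ (inj₂ (inj₂ (p , q)))  = inj₂ (inj₁ (q , p))

    irrJ : ∀ {u} → ¬ JoinAdj u u
    irrJ (inj₁ e)                     = irreflexive e
    irrJ (inj₂ (inj₁ (refl , a≡b)))   = a≢b a≡b
    irrJ (inj₂ (inj₂ (refl , b≡a)))   = a≢b (sym b≡a)

Connected : Subset n → Edges n → Set
Connected V E = ∀ u v → u ∈ V → v ∈ V → Star (Adj E) u v

-- The cycle through the distinct vertices x ∷ xs, in this order and back to x.

IsCycle : Edges n → Fin n → List (Fin n) → Set
IsCycle E x xs = 2 ≤ length xs × Unique (x ∷ xs) × Linked (Adj E) (x ∷ xs ∷ʳ x)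

Acyclic : Edges n → Set
Acyclic E = ∀ x xs → ¬ IsCycle E x xs

record IsTree (V : Subset n) (E : Edges n) : Set where
  constructor isTree
  field
    nonempty  : Nonempty V
    connected : Connected V E
    acyclic   : Acyclic E

Tree : Graph n → Set
Tree G = IsTree ⊤ (edges G)

Subgraph : ℕ → Set
Subgraph n = Subset n × Edges n

record IsSubtree (G : Graph n) (H : Subgraph n) : Set where
  constructor isSubtree
  field
    isGraphᴴ : IsGraph (proj₁ H) (proj₂ H)
    included : ∀ {u v} → Adj (proj₂ H) u v → u ~[ G ] v
    isTreeᴴ  : IsTree (proj₁ H) (proj₂ H)

order : Subgraph n → ℕ
order (V , _) = ∣ V ∣

-- Reach E ks u v: there is a walk from u to v all of whose inner vertices
-- belong to ks.

Reach : Edges n → List (Fin n) → Rel (Fin n) 0ℓ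
Reach E []       u v = u ≡ v ⊎ Adj E u v
Reach E (k ∷ ks) u v = Reach E ks u v ⊎ (Reach E ks u k × Reach E ks k v)

reach? : (E : Edges n) → ∀ ks → B.Decidable (Reach E ks)
reach? E []       u v = (u ≟ᶠ v) ⊎-dec adj? E u v
reach? E (k ∷ ks) u v =
  reach? E ks u v ⊎-dec (reach? E ks u k ×-dec reach? E ks k v)

reach⇒star : (E : Edges n) → ∀ ks {u v} → Reach E ks u v → Star (Adj E) u v
reach⇒star E []       (inj₁ refl)    = ε
reach⇒star E []       (inj₂ e)       = e ◅ ε
reach⇒star E (k ∷ ks) (inj₁ r)       = reach⇒star E ks r
reach⇒star E (k ∷ ks) (inj₂ (r , s)) = reach⇒star E ks r ◅◅ reach⇒star E ks s

reach-base : (E : Edges n) → ∀ ks {u v} → u ≡ v ⊎ Adj E u v → Reach E ks u v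
reach-base E []       r = r
reach-base E (k ∷ ks) r = inj₁ (reach-base E ks r)

reach-trans : (E : Edges n) → ∀ {ks k u v} → k ∈ᴸ ks →
              Reach E ks u k → Reach E ks k v → Reach E ks u v
reach-trans E (here refl) r s = inj₂ (left r , right s)
  where
  left : ∀ {ks u k} → Reach E (k ∷ ks) u k → Reach E ks u k
  left (inj₁ r)       = r
  left (inj₂ (r , _)) = r
  right : ∀ {ks u k} → Reach E (k ∷ ks) k u → Reach E ks k u
  right (inj₁ r)       = r
  right (inj₂ (_ , r)) = r
reach-trans E (there k∈) (inj₁ r)       (inj₁ s)       = inj₁ (reach-trans E k∈ r s)
reach-trans E (there k∈) (inj₁ r)       (inj₂ (s , t)) = inj₂ (reach-trans E k∈ r s , t)
reach-trans E (there k∈) (inj₂ (r , s)) (inj₁ t)       = inj₂ (r , reach-trans E k∈ s t)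
reach-trans E (there k∈) (inj₂ (r , _)) (inj₂ (_ , t)) = inj₂ (r , t)

star⇒reach : (E : Edges n) → ∀ {u v} → Star (Adj E) u v → Reach E (List.allFin n) u v
star⇒reach E ε       = reach-base E _ (inj₁ refl)
star⇒reach E (e ◅ s) =
  reach-trans E (∈-allFin _) (reach-base E _ (inj₂ e)) (star⇒reach E s)

star? : (E : Edges n) → B.Decidable (Star (Adj E))
star? E u v = map′ (reach⇒star E _) (star⇒reach E) (reach? E (List.allFin _) u v)

connected? : (V : Subset n) (E : Edges n) → Dec (Connected V E)
connected? V E =
  all? λ u → all? λ v → (u ∈? V) →-dec ((v ∈? V) →-dec star? E u v)

private
  lookup-inj : ∀ {A : Set} {xs : List A} → Unique xs → ∀ {i j} →
               List.lookup xs i ≡ List.lookup xs j → i ≡ j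
  lookup-inj (_  ∷ _) {zero}  {zero}  _  = refl
  lookup-inj (px ∷ _) {zero}  {suc j} eq = contradiction eq (All.lookup px (∈-lookup j))
  lookup-inj (px ∷ _) {suc i} {zero}  eq = contradiction (sym eq) (All.lookup px (∈-lookup i))
  lookup-inj (_  ∷ u) {suc i} {suc j} eq = cong suc (lookup-inj u eq)

unique⇒length≤ : {xs : List (Fin n)} → Unique xs → length xs ≤ n
unique⇒length≤ xs! = injective⇒≤ (lookup-inj xs!)

anyList? : {P : Pred (List (Fin n)) 0ℓ} → Decidable P → ∀ k →
           Dec (∃ λ xs → length xs ≤ k × P xs)
anyList? P? zero = map′ (λ p → [] , z≤n , p) (λ { ([] , _ , p) → p }) (P? [])
anyList? P? (suc k) = map′
  (λ { (inj₁ p)                  → [] , z≤n , p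
     ; (inj₂ (x , xs , l≤k , p)) → x ∷ xs , s≤s l≤k , p })
  (λ { ([]     , _       , p) → inj₁ p
     ; (x ∷ xs , s≤s l≤k , p) → inj₂ (x , xs , l≤k , p) })
  (P? [] ⊎-dec any? λ x → anyList? (P? ∘ (x ∷_)) k)

isCycle? : (E : Edges n) → ∀ x → Decidable (IsCycle E x)
isCycle? E x xs = (2 ≤? length xs) ×-dec
  (DecUnique.unique? _≟ᶠ_ (x ∷ xs) ×-dec linked? (adj? E) (x ∷ xs ∷ʳ x))

acyclic? : (E : Edges n) → Dec (Acyclic E)
acyclic? {n} E = map′
  (λ ¬c _ _ c@(_ , u , _) →
     ¬c (_ , _ , ≤-trans (n≤1+n _) (unique⇒length≤ u) , c))
  (λ { ac (x , xs , _ , c) → ac x xs c })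
  (¬? (any? λ x → anyList? (isCycle? E x) n))

isGraph? : (V : Subset n) (E : Edges n) → Dec (IsGraph V E)
isGraph? V E = map′
  (λ { (s , i , e) → isGraph (s _ _) (i _) (e _ _) })
  (λ { (isGraph s i e) → (λ _ _ → s) , (λ _ → i) , (λ _ _ → e) })
  ((all? λ u → all? λ v → adj? E u v →-dec adj? E v u) ×-dec
   ((all? λ u → ¬? (adj? E u u)) ×-dec
    (all? λ u → all? λ v → adj? E u v →-dec (u ∈? V))))

isTree? : (V : Subset n) (E : Edges n) → Dec (IsTree V E)
isTree? V E = map′
  (λ { (ne , c , a) → isTree ne c a })
  (λ { (isTree ne c a) → ne , c , a })
  (nonempty? V ×-dec (connected? V E ×-dec acyclic? E))

isSubtree? : (G : Graph n) → Decidable (IsSubtree G)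
isSubtree? G (V , E) = map′
  (λ { (g , i , t) → isSubtree g (i _ _) t })
  (λ { (isSubtree g i t) → g , (λ _ _ → i) , t })
  (isGraph? V E ×-dec
   ((all? λ u → all? λ v → adj? E u v →-dec adj? (edges G) u v) ×-dec
    isTree? V E))

allVecs : ∀ {A : Set} → List A → ∀ n → List (Vec A n)
allVecs xs zero    = [ [] ]
allVecs xs (suc n) = cartesianProductWith _∷_ xs (allVecs xs n)

allVecs-complete : ∀ {A : Set} {xs : List A} → (∀ x → x ∈ᴸ xs) →
                   (v : Vec A n) → v ∈ᴸ allVecs xs n
allVecs-complete all []      = here refl
allVecs-complete all (x ∷ v) =
  ∈-cartesianProductWith⁺ _∷_ (all x) (allVecs-complete all v)

allVecs-unique : ∀ {A : Set} {xs : List A} → Unique xs → ∀ n → Unique (allVecs xs n)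
allVecs-unique xs! zero    = [] ∷ []
allVecs-unique xs! (suc n) =
  cartesianProductWith⁺ _∷_ ∷-injective xs! (allVecs-unique xs! n)

allSubsets : ∀ n → List (Subset n)
allSubsets = allVecs (false ∷ true ∷ [])

allSubsets-complete : (V : Subset n) → V ∈ᴸ allSubsets n
allSubsets-complete = allVecs-complete
  λ { false → here refl ; true → there (here refl) }

allSubsets-unique : ∀ n → Unique (allSubsets n)
allSubsets-unique = allVecs-unique (((λ ()) ∷ []) ∷ ([] ∷ []))

allSubgraphs : ∀ n → List (Subgraph n)
allSubgraphs n = cartesianProduct (allSubsets n) (allVecs (allSubsets n) n)

subtrees : Graph n → List (Subgraph n)
subtrees G = filter (isSubtree? G) (allSubgraphs _)

subtrees-unique : (G : Graph n) → Unique (subtrees G)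
subtrees-unique {n} G = filter⁺ (isSubtree? G)
  (cartesianProduct⁺ (allSubsets-unique n) (allVecs-unique (allSubsets-unique n) n))

∈-subtrees⁺ : (G : Graph n) → ∀ {H} → IsSubtree G H → H ∈ᴸ subtrees G
∈-subtrees⁺ G {V , E} = ∈-filter⁺ (isSubtree? G)
  (∈-cartesianProduct⁺ (allSubsets-complete V) (allVecs-complete allSubsets-complete E))

∈-subtrees⁻ : (G : Graph n) → ∀ {H} → H ∈ᴸ subtrees G → IsSubtree G H
∈-subtrees⁻ {n} G H∈ = proj₂ (∈-filter⁻ (isSubtree? G) {xs = allSubgraphs n} H∈)

-- The list a₀ ∷ a₁ ∷ ⋯ of coefficients represents a₀ + a₁ x + ⋯.

Poly : Set
Poly = List ℕ

infixl 6 _⊕_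

_⊕_ : Poly → Poly → Poly
[]      ⊕ q       = q
p       ⊕ []      = p
(a ∷ p) ⊕ (b ∷ q) = a + b ∷ p ⊕ q

x^_ : ℕ → Poly
x^ k = replicate k 0 ∷ʳ 1

eval : Poly → ℕ → ℕ
eval []      x = 0
eval (a ∷ p) x = a + x * eval p x

-- (a + x p)′ = p + x p′

derivative : Poly → Poly
derivative []      = []
derivative (a ∷ p) = p ⊕ (0 ∷ derivative p)

eval-⊕ : ∀ p q x → eval (p ⊕ q) x ≡ eval p x + eval q x
eval-⊕ []      q       x = refl
eval-⊕ (a ∷ p) []      x = sym (+-identityʳ _)
eval-⊕ (a ∷ p) (b ∷ q) x rewrite eval-⊕ p q x =
  solve 5 (λ a b x p q → a :+ b :+ x :* (p :+ q) := a :+ x :* p :+ (b :+ x :* q))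
    refl a b x (eval p x) (eval q x)
  where open +-*-Solver

eval-derivative-⊕ : ∀ p q x →
  eval (derivative (p ⊕ q)) x ≡ eval (derivative p) x + eval (derivative q) x
eval-derivative-⊕ []      q       x = refl
eval-derivative-⊕ (a ∷ p) []      x = sym (+-identityʳ _)
eval-derivative-⊕ (a ∷ p) (b ∷ q) x
  rewrite eval-⊕ (p ⊕ q) (0 ∷ derivative (p ⊕ q)) x
        | eval-⊕ p (0 ∷ derivative p) x
        | eval-⊕ q (0 ∷ derivative q) x
        | eval-⊕ p q x
        | eval-derivative-⊕ p q x =
  solve 5 (λ x p q p′ q′ →
      p :+ q :+ x :* (p′ :+ q′) := p :+ x :* p′ :+ (q :+ x :* q′))
    refl x (eval p x) (eval q x) (eval (derivative p) x) (eval (derivative q) x)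
  where open +-*-Solver

eval-x^ : ∀ k → eval (x^ k) 1 ≡ 1
eval-x^ zero    = refl
eval-x^ (suc k) = trans (+-identityʳ _) (eval-x^ k)

eval-derivative-x^ : ∀ k → eval (derivative (x^ k)) 1 ≡ k
eval-derivative-x^ zero    = refl
eval-derivative-x^ (suc k)
  rewrite eval-⊕ (x^ k) (0 ∷ derivative (x^ k)) 1
        | eval-x^ k
        | eval-derivative-x^ k = cong suc (+-identityʳ k)

S : Graph n → Poly
S G = foldr _⊕_ [] (map (λ T → x^ order T) (subtrees G))

S[1]≡number : (G : Graph n) → eval (S G) 1 ≡ length (subtrees G)
S[1]≡number G = go (subtrees G)
  where
  go : ∀ Ts → eval (foldr _⊕_ [] (map (λ T → x^ order T) Ts)) 1 ≡ length Ts
  go []       = refl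
  go (T ∷ Ts) = trans (eval-⊕ (x^ order T) _ 1) (cong₂ _+_ (eval-x^ (order T)) (go Ts))

S′[1]≡total-order : (G : Graph n) →
  eval (derivative (S G)) 1 ≡ sum (map order (subtrees G))
S′[1]≡total-order G = go (subtrees G)
  where
  go : ∀ Ts → eval (derivative (foldr _⊕_ [] (map (λ T → x^ order T) Ts))) 1
            ≡ sum (map order Ts)
  go []       = refl
  go (T ∷ Ts) = trans (eval-derivative-⊕ (x^ order T) _ 1)
    (cong₂ _+_ (eval-derivative-x^ (order T)) (go Ts))

noEdges : Edges n
noEdges = Vec.replicate _ ∅

¬adj-noEdges : ∀ {u v : Fin n} → ¬ Adj noEdges u v
¬adj-noEdges {u = u} {v} e = ∉⊥ (subst (v ∈_) (lookup-replicate u ∅) e)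

singleton-isSubtree : (G : Graph n) (v : Fin n) → IsSubtree G (⁅ v ⁆ , noEdges)
singleton-isSubtree G v = isSubtree
  (isGraph (λ e → contradiction e ¬adj-noEdges) ¬adj-noEdges
           (λ e → contradiction e ¬adj-noEdges))
  (λ e → contradiction e ¬adj-noEdges)
  (isTree (v , x∈⁅x⁆ v) conn
          (λ { _ []      (() , _)
             ; _ (_ ∷ _) (_ , _ , e ∷ _) → ¬adj-noEdges e }))
  where
  conn : Connected ⁅ v ⁆ noEdges
  conn _ _ u∈ w∈ with refl ← x∈⁅y⁆⇒x≡y v u∈ | refl ← x∈⁅y⁆⇒x≡y v w∈ = ε

S[1]-nonZero : (G : Graph n) .{{_ : NonZero n}} → NonZero (eval (S G) 1)
S[1]-nonZero {suc n} G = subst NonZero (sym (S[1]≡number G))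
  (nonEmpty (∈-subtrees⁺ G (singleton-isSubtree G zero)))
  where
  nonEmpty : ∀ {A : Set} {x : A} {xs} → x ∈ᴸ xs → NonZero (length xs)
  nonEmpty {xs = _ ∷ _} _ = _

-- A graph without vertices has no subtrees, hence no mean subtree order.

μ : (G : Graph n) .{{_ : NonZero n}} → ℚ
μ G = (+ eval (derivative (S G)) 1 / eval (S G) 1) {{S[1]-nonZero G}}

-- Let u be a leaf of T, w its neighbour and v another neighbour of w; let A and B
-- be the components of w and v in T - u - wv. The subtrees of T + uv that are not
-- subtrees of T are those containing uv: each is obtained by joining disjoint
-- subtrees of T through u and v. The mean order of these new subtrees exceeds the
-- mean order of the subtrees of T through w as soon as the mean order of the
-- subtrees of A through w is at most their number. By Jamison's theorem the mean
-- at w is at least μ(T), so adding the new subtrees raises the mean.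

module Submission where

open import Defs
open import Data.Fin.Base using (Fin)
open import Data.Fin.Properties using (any?) renaming (_≟_ to _≟ᶠ_)
open import Data.Fin.Subset using (Subset; ⊤; inside; outside; ⁅_⁆; _∈_; _∉_; ∣_∣; _∪_)
open import Data.Fin.Subset.Properties
  using (_∈?_; ∈⊤; ∣⊤∣≡n; ⊆-antisym; p⊆q⇒∣p∣≤∣q∣; x∈p∪q⁺; x∈p∪q⁻; x∈⁅x⁆; x∈⁅y⁆⇒x≡y; ∣⁅x⁆∣≡1)
import Data.Integer as ℤ
import Data.Integer.Properties as ℤ
open import Data.List.Base
  using (List; []; _∷_; _∷ʳ_; _++_; map; length; cartesianProductWith)
import Data.List.Membership.DecPropositional as DecMembership
open import Data.List.Membership.Propositional using () renaming (_∈_ to _∈ᴸ_)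
open import Data.List.Membership.Propositional.Properties
  using (∈-map⁻; ∈-++⁺ˡ; ∈-++⁺ʳ; ∈-++⁻; ∈-cartesianProductWith⁺; ∈-cartesianProductWith⁻)
open import Data.List.Membership.Propositional.Properties.WithK using (unique∧set⇒bag)
open import Data.List.Properties using (length-++; length-map; map-++)
open import Data.List.Relation.Binary.BagAndSetEquality using (∼bag⇒↭)
open import Data.List.Relation.Binary.Permutation.Propositional using (_↭_)
open import Data.List.Relation.Binary.Permutation.Propositional.Properties
  using (↭-length) renaming (map⁺ to ↭-map⁺)
open import Data.List.Relation.Unary.All as All using (All; []; _∷_)
open import Data.List.Relation.Unary.All.Properties using (¬Any⇒All¬)
open import Data.List.Relation.Unary.AllPairs using (AllPairs; []; _∷_)
import Data.List.Relation.Unary.AllPairs.Properties as AllPairs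
open import Data.List.Relation.Unary.Any using (here; there)
open import Data.List.Relation.Unary.Linked using (Linked; [-]; _∷_)
open import Data.List.Relation.Unary.Unique.Propositional using (Unique)
import Data.List.Relation.Unary.Unique.Propositional.Properties as Unique
open import Data.Nat using (ℕ; suc; _+_; _*_; _≤_; _<_; _≥_; z≤n; s≤s; NonZero)
open import Data.Nat.Induction using (Acc; acc; <-wellFounded)
open import Data.Nat.ListAction using (sum)
open import Data.Nat.ListAction.Properties using (sum-++; sum-↭)
open import Data.Nat.Properties
  using (+-suc; m<m+n; m<n+m; m≤m+n; m≤n⇒∃[o]m+o≡n; ≤-trans; ≤-reflexive; +-mono-≤; +-monoʳ-≤;
         +-monoʳ-<; +-cancelʳ-≤; +-cancelʳ-<; *-monoˡ-≤; *-monoʳ-≤; *-monoˡ-<; *-cancelʳ-≤;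
         *-cancelʳ-<; *-distribˡ-+; *-distribʳ-+; module ≤-Reasoning)
open import Data.Nat.Solver using (module +-*-Solver)
open import Data.Product using (Σ; ∃; ∃₂; _×_; _,_; proj₁; proj₂)
open import Data.Rational as ℚ using (_/_; _>_)
import Data.Rational.Properties as ℚ
open import Data.Rational.Unnormalised using (mkℚᵘ; *<*)
import Data.Rational.Unnormalised.Properties as ℚᵘ
open import Data.Sum as Sum using (_⊎_; inj₁; inj₂; swap)
open import Data.Vec.Base using ([]; _∷_; here; there; tabulate)
open import Data.Vec.Properties
  using (lookup∘tabulate; tabulate∘lookup; tabulate-cong; []=⇒lookup; lookup⇒[]=)
open import Function using (_∘_; flip; mk⇔)
open import Level using (0ℓ)
open import Relation.Binary using (Rel; Symmetric)
open import Relation.Binary.Construct.Closure.ReflexiveTransitive as Star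
  using (Star; ε; _◅_; _◅◅_; kleisliStar)
import Relation.Binary.Definitions as B
open import Relation.Binary.PropositionalEquality
  using (_≡_; _≢_; refl; sym; trans; cong; cong₂; subst; subst₂)
open import Relation.Nullary using (¬_; Dec; yes; no; does; contradiction)
open import Relation.Nullary.Decidable using (_×-dec_; _⊎-dec_; ¬?; dec-true)
open import Relation.Unary using (Pred; Decidable)

open +-*-Solver using (solve; con; _:+_; _:*_; _:=_)

-- The comparison at w can be made factor by factor. Let the subtrees of A through w be a in number,
-- with mean order m. A subtree of T through w contains the leaf u in half of the cases, a new one
-- always: a gain of 1/2. It contains v only sometimes, a new one always, so the part in B gains as
-- well. Only the part in A loses: each subtree of B through v extends to 1 + 2a new subtrees,
-- namely one that avoids w and, for each of the a choices in A, one with the edge wv and one with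
-- the edge wu. Both edges at once would close the triangle uvw. Hence A contributes 2am/(1 + 2a) on
-- average instead of m, and the loss m/(1 + 2a) stays below 1/2 when m is at most a. All of this
-- multiplies counts of independent choices, so subtrees are enumerated by lists built along a
-- recursive presentation of the tree. Trees are handled as connected graphs whose edges are
-- bridges, a condition that passes easily through cutting and gluing at an edge.

private
  variable
    n : ℕ
    X Y Z W : Subgraph n
    a b c p q r u v w x y z : Fin n

-- Subgraphs

module _ {P : Pred (Fin n) 0ℓ} (P? : Decidable P) where

  fromPred : Subset n
  fromPred = tabulate λ x → does (P? x)

  fromPred⁺ : P x → x ∈ fromPred
  fromPred⁺ {x} px =
    lookup⇒[]= x _ (trans (lookup∘tabulate _ x) (dec-true (P? x) px))

  fromPred⁻ : x ∈ fromPred → P x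
  fromPred⁻ {x} x∈
    with P? x | trans (sym (lookup∘tabulate (λ y → does (P? y)) x)) ([]=⇒lookup x∈)
  ... | yes px | _  = px
  ... | no  _  | ()

infix 4 _∈ⱽ_ _∉ⱽ_ _∈ⱽ?_ _⊑_

-- Membership, adjacency and the basic subgraphs are opaque so that Agda can
-- infer the subgraph from a statement about it.
opaque

  _∈ⱽ_ : Fin n → Subgraph n → Set
  x ∈ⱽ X = x ∈ proj₁ X

  Link : Subgraph n → Rel (Fin n) 0ℓ
  Link X = Adj (proj₂ X)

_∉ⱽ_ : Fin n → Subgraph n → Set
x ∉ⱽ X = ¬ x ∈ⱽ X

record _⊑_ (X Y : Subgraph n) : Set where
  constructor _,_
  field
    vertices⊑ : x ∈ⱽ X → x ∈ⱽ Y
    links⊑    : Link X x y → Link Y x y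

open _⊑_

opaque
  unfolding _∈ⱽ_ Link

  _∈ⱽ?_ : (x : Fin n) (X : Subgraph n) → Dec (x ∈ⱽ X)
  x ∈ⱽ? X = x ∈? proj₁ X

  link? : (X : Subgraph n) → B.Decidable (Link X)
  link? X = adj? (proj₂ X)

  ⊑-antisym : X ⊑ Y → Y ⊑ X → X ≡ Y
  ⊑-antisym {X = _ , E} {Y = _ , F} f g =
    cong₂ _,_ (⊆-antisym (vertices⊑ f) (vertices⊑ g))
      (trans (sym (tabulate∘lookup E))
        (trans (tabulate-cong λ _ → ⊆-antisym (links⊑ f) (links⊑ g)) (tabulate∘lookup F)))

  single : Fin n → Subgraph n
  single r = ⁅ r ⁆ , noEdges

  ∈-single⁺ : r ∈ⱽ single r
  ∈-single⁺ = x∈⁅x⁆ _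

  ∈-single⁻ : x ∈ⱽ single r → x ≡ r
  ∈-single⁻ = x∈⁅y⁆⇒x≡y _

  ¬link-single : ¬ Link (single r) x y
  ¬link-single = ¬adj-noEdges

  order-single : (r : Fin n) → order (single r) ≡ 1
  order-single = ∣⁅x⁆∣≡1

  1≤order : x ∈ⱽ X → 1 ≤ order X
  1≤order {x = x} {X} x∈ =
    subst (_≤ order X) (∣⁅x⁆∣≡1 x)
      (p⊆q⇒∣p∣≤∣q∣ λ y∈ → subst (_∈ proj₁ X) (sym (x∈⁅y⁆⇒x≡y x y∈)) x∈)

module _ {P : Pred (Fin n) 0ℓ} (P? : Decidable P)
         {R : Rel (Fin n) 0ℓ} (R? : B.Decidable R) where

  opaque
    unfolding _∈ⱽ_ Link

    subgraph : Subgraph n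
    subgraph = fromPred P? , fromDec R?

    ∈-subgraph⁺ : P x → x ∈ⱽ subgraph
    ∈-subgraph⁺ = fromPred⁺ P?

    ∈-subgraph⁻ : x ∈ⱽ subgraph → P x
    ∈-subgraph⁻ = fromPred⁻ P?

    link-subgraph⁺ : R x y → Link subgraph x y
    link-subgraph⁺ = fromDec⁺ R?

    link-subgraph⁻ : Link subgraph x y → R x y
    link-subgraph⁻ = fromDec⁻ R?

⊑-refl : X ⊑ X
⊑-refl = (λ x∈ → x∈) , (λ e → e)

⊑-trans : X ⊑ Y → Y ⊑ Z → X ⊑ Z
⊑-trans f g = (vertices⊑ g ∘ vertices⊑ f) , (links⊑ g ∘ links⊑ f)

Disjoint : Subgraph n → Subgraph n → Set
Disjoint X Y = ∀ {x} → x ∈ⱽ X → x ∉ⱽ Y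

-- Bridges and cycles

Same : Fin n → Fin n → Rel (Fin n) 0ℓ
Same a b x y = (x ≡ a × y ≡ b) ⊎ (x ≡ b × y ≡ a)

same? : (a b : Fin n) → B.Decidable (Same a b)
same? a b x y = ((x ≟ᶠ a) ×-dec (y ≟ᶠ b)) ⊎-dec ((x ≟ᶠ b) ×-dec (y ≟ᶠ a))

same-sym : Symmetric (Same a b)
same-sym (inj₁ (p , q)) = inj₂ (q , p)
same-sym (inj₂ (p , q)) = inj₁ (q , p)

Removed : Subgraph n → Fin n → Fin n → Rel (Fin n) 0ℓ
Removed X a b x y = Link X x y × ¬ Same a b x y

removed? : (X : Subgraph n) (a b : Fin n) → B.Decidable (Removed X a b)
removed? X a b x y = link? X x y ×-dec ¬? (same? a b x y)

-- This stands in for acyclicity: it speaks of walks, which can be mapped and concatenated freely,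
-- whereas a cycle is a list of distinct vertices that would have to be cut up and rearranged.
Bridges : Subgraph n → Set
Bridges X = ∀ {a b} → Link X a b → ¬ Star (Removed X a b) a b

data Path (R : Rel (Fin n) 0ℓ) : Fin n → Fin n → List (Fin n) → Set where
  stop : Path R x x []
  step : ∀ {ys} → R x y → All (x ≢_) (y ∷ ys) → Path R y z ys → Path R x z (y ∷ ys)

module _ {R : Rel (Fin n) 0ℓ} where

  suffix : ∀ {ys} → Path R y z ys → x ∈ᴸ y ∷ ys → ∃ (Path R x z)
  suffix p            (here refl) = _ , p
  suffix (step _ _ p) (there x∈)  = suffix p x∈

  -- Loop erasure: if `x` occurs again on the path already found from `y`, the suffix starting at
  -- that occurrence is taken instead.
  star⇒path : Star R x z → ∃ (Path R x z)
  star⇒path ε = _ , stop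
  star⇒path {x = x} (_◅_ {j = y} r s) with ys , p ← star⇒path s
    with DecMembership._∈?_ _≟ᶠ_ x (y ∷ ys)
  ... | yes x∈ = suffix p x∈
  ... | no  x∉ = _ , step r (¬Any⇒All¬ _ x∉) p

  path-unique : ∀ {ys} → Path R x z ys → Unique (x ∷ ys)
  path-unique stop          = [] ∷ []
  path-unique (step _ x∉ p) = x∉ ∷ path-unique p

  path-linked : ∀ {S : Rel (Fin n) 0ℓ} {ys} → (∀ {x y} → R x y → S x y) →
                Path R x z ys → S z w → Linked S (x ∷ ys ∷ʳ w)
  path-linked R⊆E stop         e = e ∷ [-]
  path-linked R⊆E (step r _ p) e = R⊆E r ∷ path-linked R⊆E p e

-- Each step of the walk starts at a vertex of `z ∷ zs`, which is neither `a` nor `b`, so no step is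
-- the removed edge. The last vertex `w` is unrestricted and may be one of the two.
linked⇒removed : ∀ {zs} → All (a ≢_) (z ∷ zs) → All (b ≢_) (z ∷ zs) →
                 Linked (Link X) (z ∷ zs ∷ʳ w) → Star (Removed X a b) z w
linked⇒removed {zs = []} (a≢ ∷ _) (b≢ ∷ _) (e ∷ [-]) =
  (e , λ { (inj₁ (p , _)) → a≢ (sym p) ; (inj₂ (p , _)) → b≢ (sym p) }) ◅ ε
linked⇒removed {zs = _ ∷ _} (a≢ ∷ a∉) (b≢ ∷ b∉) (e ∷ l) =
  (e , λ { (inj₁ (p , _)) → a≢ (sym p) ; (inj₂ (p , _)) → b≢ (sym p) })
    ◅ linked⇒removed a∉ b∉ l

module _ {X : Subgraph n} (symmetric : ∀ {x y} → Link X x y → Link X y x) where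

  opaque
    unfolding Link

    -- A detour closes up with the removed edge to a cycle. The two cases too short for a cycle
    -- would be a loop and the removed edge itself.
    acyclic⇒bridges : (∀ {x} → ¬ Link X x x) → Acyclic (proj₂ X) → Bridges X
    acyclic⇒bridges irreflexive acyclic {a} e s with star⇒path s
    ... | []        , stop                 = irreflexive e
    ... | _ ∷ []    , step (_ , ne) _ stop = ne (inj₁ (refl , refl))
    ... | _ ∷ _ ∷ _ , p                    =
      acyclic a _ (s≤s (s≤s z≤n) , path-unique p , path-linked proj₁ p (symmetric e))

    -- The rest of a cycle, from `y` through `z` back to `x`, bypasses the edge between `y` and `x`.
    bridges⇒acyclic : Bridges X → Acyclic (proj₂ X)
    bridges⇒acyclic bridges x (_ ∷ []) (s≤s () , _)
    bridges⇒acyclic bridges x (y ∷ z ∷ zs)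
      (_ , (x≢y ∷ x≢z ∷ x∉) ∷ (y≢z ∷ y∉) ∷ _ , e ∷ f ∷ l) =
      bridges (symmetric e)
        ((f , λ { (inj₁ (_ , z≡x)) → x≢z (sym z≡x) ; (inj₂ (y≡x , _)) → x≢y (sym y≡x) })
          ◅ linked⇒removed {X = X} (y≢z ∷ y∉) (x≢z ∷ x∉) l)

-- The tree condition without a host graph, so that the same pieces serve both for the given tree
-- and for the graph with the additional edge.
record IsTreeGraph (X : Subgraph n) : Set where
  field
    symmetric   : Link X x y → Link X y x
    irreflexive : ¬ Link X x x
    endpoint    : Link X x y → x ∈ⱽ X
    root        : Fin n
    root∈       : root ∈ⱽ X
    connected   : x ∈ⱽ X → y ∈ⱽ X → Star (Link X) x y
    bridges     : Bridges X

  endpointʳ : Link X x y → y ∈ⱽ X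
  endpointʳ e = endpoint (symmetric e)

open IsTreeGraph

opaque
  unfolding _∈ⱽ_ Link

  isSubtree⇒isTreeGraph : ∀ {G : Graph n} → IsSubtree G X → IsTreeGraph X
  isSubtree⇒isTreeGraph {X = X} (isSubtree (isGraph s i e) _ (isTree (r , r∈) c a)) = record
    { symmetric = s ; irreflexive = i ; endpoint = e ; root = r ; root∈ = r∈
    ; connected = c _ _ ; bridges = acyclic⇒bridges {X = X} s i a }

  isTreeGraph⇒isSubtree : ∀ {G : Graph n} → IsTreeGraph X →
    (∀ {u v} → Link X u v → u ~[ G ] v) → IsSubtree G X
  isTreeGraph⇒isSubtree {X = X} t X⊆G = isSubtree
    (isGraph (symmetric t) (irreflexive t) (endpoint t)) X⊆G
    (isTree (root t , root∈ t) (λ _ _ → connected t)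
      (bridges⇒acyclic {X = X} (symmetric t) (bridges t)))

closed : ∀ {R : Rel (Fin n) 0ℓ} (P : Pred (Fin n) 0ℓ) →
         (∀ {x y} → R x y → P x → P y) → Star R x y → P x → P y
closed P stay ε       px = px
closed P stay (r ◅ s) px = closed P stay s (stay r px)

-- Trees with one vertex

single-isTreeGraph : (r : Fin n) → IsTreeGraph (single r)
single-isTreeGraph r = record
  { symmetric   = λ e → contradiction e ¬link-single
  ; irreflexive = ¬link-single
  ; endpoint    = λ e → contradiction e ¬link-single
  ; root        = r
  ; root∈       = ∈-single⁺
  ; connected   = λ x∈ y∈ →
      subst₂ (Star (Link (single r))) (sym (∈-single⁻ x∈)) (sym (∈-single⁻ y∈)) ε
  ; bridges     = λ e → contradiction e ¬link-single
  }

isolated⇒single : IsTreeGraph X → r ∈ⱽ X → (∀ {x} → ¬ Link X r x) → X ≡ single r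
isolated⇒single {X = X} {r = r} t r∈ isolated = ⊑-antisym
  ( (λ x∈ → subst (_∈ⱽ single r) (only x∈) ∈-single⁺)
  , (λ e → contradiction (subst (λ z → Link X z _) (sym (only (endpoint t e))) e) isolated))
  ( (λ x∈ → subst (_∈ⱽ X) (sym (∈-single⁻ x∈)) r∈)
  , (λ e → contradiction e ¬link-single))
  where
  only : x ∈ⱽ X → r ≡ x
  only x∈ with connected t r∈ x∈
  ... | ε     = refl
  ... | e ◅ _ = contradiction e isolated

-- Gluing along an edge

GlueLink : Subgraph n → Fin n → Fin n → Subgraph n → Rel (Fin n) 0ℓ
GlueLink X a b Y x y = Link X x y ⊎ Link Y x y ⊎ Same a b x y

glueLink? : ∀ X a b Y → B.Decidable (GlueLink {n} X a b Y)
glueLink? X a b Y x y = link? X x y ⊎-dec link? Y x y ⊎-dec same? a b x y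

glue∈? : ∀ (X Y : Subgraph n) → Decidable (λ x → x ∈ⱽ X ⊎ x ∈ⱽ Y)
glue∈? X Y x = x ∈ⱽ? X ⊎-dec x ∈ⱽ? Y

opaque

  glue : Subgraph n → Fin n → Fin n → Subgraph n → Subgraph n
  glue X a b Y = subgraph (glue∈? X Y) (glueLink? X a b Y)

module _ {X : Subgraph n} {a b : Fin n} {Y : Subgraph n} where

  opaque
    unfolding glue

    glue-link⁺ : GlueLink X a b Y x y → Link (glue X a b Y) x y
    glue-link⁺ = link-subgraph⁺ (glue∈? X Y) (glueLink? X a b Y)

    glue-link⁻ : Link (glue X a b Y) x y → GlueLink X a b Y x y
    glue-link⁻ = link-subgraph⁻ (glue∈? X Y) (glueLink? X a b Y)

    glue-∈⁺ : x ∈ⱽ X ⊎ x ∈ⱽ Y → x ∈ⱽ glue X a b Y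
    glue-∈⁺ = ∈-subgraph⁺ (glue∈? X Y) (glueLink? X a b Y)

    glue-∈⁻ : x ∈ⱽ glue X a b Y → x ∈ⱽ X ⊎ x ∈ⱽ Y
    glue-∈⁻ = ∈-subgraph⁻ (glue∈? X Y) (glueLink? X a b Y)

  glue-⊑ˡ : X ⊑ glue X a b Y
  glue-⊑ˡ = (glue-∈⁺ ∘ inj₁) , (glue-link⁺ ∘ inj₁)

  glue-⊑ʳ : Y ⊑ glue X a b Y
  glue-⊑ʳ = (glue-∈⁺ ∘ inj₂) , (glue-link⁺ ∘ inj₂ ∘ inj₁)

  glue-bridge : Link (glue X a b Y) a b
  glue-bridge = glue-link⁺ (inj₂ (inj₂ (inj₁ (refl , refl))))

  glue-least : (∀ {x y} → Link Z x y → Link Z y x) →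
               X ⊑ Z → Y ⊑ Z → Link Z a b → glue X a b Y ⊑ Z
  glue-least {Z = Z} symZ X⊑Z Y⊑Z e = vs , (ls ∘ glue-link⁻)
    where
    vs : x ∈ⱽ glue X a b Y → x ∈ⱽ Z
    vs x∈ with glue-∈⁻ x∈
    ... | inj₁ x∈X = vertices⊑ X⊑Z x∈X
    ... | inj₂ x∈Y = vertices⊑ Y⊑Z x∈Y
    ls : GlueLink X a b Y x y → Link Z x y
    ls (inj₁ f)                           = links⊑ X⊑Z f
    ls (inj₂ (inj₁ f))                    = links⊑ Y⊑Z f
    ls (inj₂ (inj₂ (inj₁ (refl , refl)))) = e
    ls (inj₂ (inj₂ (inj₂ (refl , refl)))) = symZ e

glue-comm : ∀ {X : Subgraph n} {a b Y} → glue X a b Y ≡ glue Y b a X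
glue-comm = ⊑-antisym half half
  where
  turn : ∀ {X : Subgraph n} {a b Y x y} → GlueLink X a b Y x y → GlueLink Y b a X x y
  turn (inj₁ e)               = inj₂ (inj₁ e)
  turn (inj₂ (inj₁ e))        = inj₁ e
  turn (inj₂ (inj₂ s))        = inj₂ (inj₂ (swap s))
  half : ∀ {X : Subgraph n} {a b Y} → glue X a b Y ⊑ glue Y b a X
  half {X = X} {a} {b} {Y} =
    (glue-∈⁺ ∘ swap ∘ glue-∈⁻) ,
    (glue-link⁺ ∘ turn ∘ glue-link⁻)

pull : Subgraph n → Fin n → Fin n → Fin n
pull X a z with z ∈ⱽ? X
... | yes _ = z
... | no  _ = a

pull-∈ : ∀ (X : Subgraph n) → z ∈ⱽ X → pull X a z ≡ z
pull-∈ {z = z} X z∈ with z ∈ⱽ? X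
... | yes _ = refl
... | no z∉ = contradiction z∈ z∉

pull-∉ : ∀ (X : Subgraph n) → z ∉ⱽ X → pull X a z ≡ a
pull-∉ {z = z} X z∉ with z ∈ⱽ? X
... | yes z∈ = contradiction z∈ z∉
... | no _   = refl

module _ {X Y : Subgraph n} (tX : IsTreeGraph X) (tY : IsTreeGraph Y)
         (X#Y : Disjoint X Y) (a∈X : a ∈ⱽ X) (b∈Y : b ∈ⱽ Y) where

  private
    K = glue X a b Y

  glue-irreflexive : ¬ Link K x x
  glue-irreflexive e with glue-link⁻ e
  ... | inj₁ f                           = irreflexive tX f
  ... | inj₂ (inj₁ f)                    = irreflexive tY f
  ... | inj₂ (inj₂ (inj₁ (refl , refl))) = X#Y a∈X b∈Y
  ... | inj₂ (inj₂ (inj₂ (refl , refl))) = X#Y a∈X b∈Y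

  glue-symmetric : Link K x y → Link K y x
  glue-symmetric e with glue-link⁻ e
  ... | inj₁ f        = glue-link⁺ (inj₁ (symmetric tX f))
  ... | inj₂ (inj₁ f) = glue-link⁺ (inj₂ (inj₁ (symmetric tY f)))
  ... | inj₂ (inj₂ s) = glue-link⁺ (inj₂ (inj₂ (same-sym s)))

  glue-endpoint : Link K x y → x ∈ⱽ K
  glue-endpoint e with glue-link⁻ e
  ... | inj₁ f                        = glue-∈⁺ (inj₁ (endpoint tX f))
  ... | inj₂ (inj₁ f)                 = glue-∈⁺ (inj₂ (endpoint tY f))
  ... | inj₂ (inj₂ (inj₁ (refl , _))) = glue-∈⁺ (inj₁ a∈X)
  ... | inj₂ (inj₂ (inj₂ (refl , _))) = glue-∈⁺ (inj₂ b∈Y)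

  glue-connected : x ∈ⱽ K → y ∈ⱽ K → Star (Link K) x y
  glue-connected x∈ y∈ = to-a x∈ ◅◅ Star.reverse glue-symmetric (to-a y∈)
    where
    to-a : z ∈ⱽ K → Star (Link K) z a
    to-a z∈ with glue-∈⁻ z∈
    ... | inj₁ z∈X = Star.map (glue-link⁺ ∘ inj₁) (connected tX z∈X a∈X)
    ... | inj₂ z∈Y = Star.map (glue-link⁺ ∘ inj₂ ∘ inj₁) (connected tY z∈Y b∈Y)
                     ◅◅ glue-symmetric (glue-bridge) ◅ ε

  -- Contracting Y to the vertex a turns a detour in the glued graph into one in X.
  glue-bridgesˡ : Link X p q → ¬ Star (Removed K p q) p q
  glue-bridgesˡ {p} {q} e s = bridges tX e
    (subst₂ (Star (Removed X p q))
      (pull-∈ X (endpoint tX e)) (pull-∈ X (endpointʳ tX e))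
      (kleisliStar (pull X a) contract s))
    where
    contract : Removed K p q x y →
               Star (Removed X p q) (pull X a x) (pull X a y)
    contract (k , ne) with glue-link⁻ k
    ... | inj₁ f
      rewrite pull-∈ {a = a} X (endpoint tX f) | pull-∈ {a = a} X (endpointʳ tX f) =
        (f , ne) ◅ ε
    ... | inj₂ (inj₁ f)
      rewrite pull-∉ {a = a} X (flip X#Y (endpoint tY f))
            | pull-∉ {a = a} X (flip X#Y (endpointʳ tY f)) = ε
    ... | inj₂ (inj₂ (inj₁ (refl , refl)))
      rewrite pull-∈ {a = a} X a∈X | pull-∉ {a = a} X (flip X#Y b∈Y) = ε
    ... | inj₂ (inj₂ (inj₂ (refl , refl)))
      rewrite pull-∈ {a = a} X a∈X | pull-∉ {a = a} X (flip X#Y b∈Y) = ε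

  -- Without the edge between `a` and `b`, no walk that starts in `X` can leave `X`.
  glue-bridgeᵐ : ¬ Star (Removed K a b) a b
  glue-bridgeᵐ s = flip X#Y b∈Y (closed (_∈ⱽ X) stay s a∈X)
    where
    stay : Removed K a b x y → x ∈ⱽ X → y ∈ⱽ X
    stay (k , ne) x∈ with glue-link⁻ k
    ... | inj₁ f           = endpointʳ tX f
    ... | inj₂ (inj₁ f)    = contradiction (endpoint tY f) (X#Y x∈)
    ... | inj₂ (inj₂ same) = contradiction same ne

glue-isTreeGraph : IsTreeGraph X → IsTreeGraph Y → Disjoint X Y → a ∈ⱽ X → b ∈ⱽ Y →
                   IsTreeGraph (glue X a b Y)
glue-isTreeGraph {X = X} {Y = Y} {a = a} {b = b} tX tY X#Y a∈X b∈Y = record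
  { symmetric   = glue-symmetric tX tY X#Y a∈X b∈Y
  ; irreflexive = glue-irreflexive tX tY X#Y a∈X b∈Y
  ; endpoint    = glue-endpoint tX tY X#Y a∈X b∈Y
  ; root        = a
  ; root∈       = glue-∈⁺ (inj₁ a∈X)
  ; connected   = glue-connected tX tY X#Y a∈X b∈Y
  ; bridges     = bridge
  }
  where
  transpose : Star (Removed (glue X a b Y) p q) x y →
              Star (Removed (glue Y b a X) p q) x y
  transpose {p = p} {q} {x} {y} =
    subst (λ K → Star (Removed K p q) x y) (glue-comm {X = X} {a} {b} {Y})
  bridge : Bridges (glue X a b Y)
  bridge e s with glue-link⁻ e
  ... | inj₁ f        = glue-bridgesˡ tX tY X#Y a∈X b∈Y f s
  ... | inj₂ (inj₁ f) =
    glue-bridgesˡ tY tX (flip X#Y) b∈Y a∈X f (transpose s)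
  ... | inj₂ (inj₂ (inj₁ (refl , refl))) = glue-bridgeᵐ tX tY X#Y a∈X b∈Y s
  ... | inj₂ (inj₂ (inj₂ (refl , refl))) =
    glue-bridgeᵐ tY tX (flip X#Y) b∈Y a∈X (transpose s)

∣∪∣-disjoint : (p q : Subset n) → (∀ {x} → x ∈ p → x ∉ q) → ∣ p ∪ q ∣ ≡ ∣ p ∣ + ∣ q ∣
∣∪∣-disjoint []            []            p#q = refl
∣∪∣-disjoint (inside  ∷ p) (inside  ∷ q) p#q = contradiction here (p#q here)
∣∪∣-disjoint (inside  ∷ p) (outside ∷ q) p#q =
  cong suc (∣∪∣-disjoint p q λ x∈ x∈′ → p#q (there x∈) (there x∈′))
∣∪∣-disjoint (outside ∷ p) (inside  ∷ q) p#q =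
  trans (cong suc (∣∪∣-disjoint p q λ x∈ x∈′ → p#q (there x∈) (there x∈′)))
        (sym (+-suc ∣ p ∣ ∣ q ∣))
∣∪∣-disjoint (outside ∷ p) (outside ∷ q) p#q =
  ∣∪∣-disjoint p q λ x∈ x∈′ → p#q (there x∈) (there x∈′)

opaque
  unfolding _∈ⱽ_ glue subgraph

  order-glue : Disjoint X Y → order (glue X a b Y) ≡ order X + order Y
  order-glue {X = X} {Y} X#Y = trans
    (cong ∣_∣ (⊆-antisym (x∈p∪q⁺ ∘ fromPred⁻ (glue∈? X Y))
                         (fromPred⁺ (glue∈? X Y) ∘ x∈p∪q⁻ (proj₁ X) (proj₁ Y))))
    (∣∪∣-disjoint (proj₁ X) (proj₁ Y) X#Y)

-- Splitting at an edge

module _ (Z : Subgraph n) (a b : Fin n) where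

  private
    -- Reachability is decided by `star?` for an adjacency matrix, so the relation is tabulated
    -- first.
    D = fromDec (removed? Z a b)

    reached? : ∀ r → Decidable (Star (Adj D) r)
    reached? = star? D

    ComponentLink : Fin n → Rel (Fin n) 0ℓ
    ComponentLink r x y = Removed Z a b x y × Star (Adj D) r x

    componentLink? : ∀ r → B.Decidable (ComponentLink r)
    componentLink? r x y = removed? Z a b x y ×-dec reached? r x

  component : Fin n → Subgraph n
  component r = subgraph (reached? r) (componentLink? r)

  ∈-component⁺ : Star (Removed Z a b) r x → x ∈ⱽ component r
  ∈-component⁺ {r = r} s =
    ∈-subgraph⁺ (reached? r) (componentLink? r) (Star.map (fromDec⁺ (removed? Z a b)) s)

  ∈-component⁻ : x ∈ⱽ component r → Star (Removed Z a b) r x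
  ∈-component⁻ {r = r} x∈ =
    Star.map (fromDec⁻ (removed? Z a b)) (∈-subgraph⁻ (reached? r) (componentLink? r) x∈)

  component-link⁺ : Removed Z a b x y → x ∈ⱽ component r → Link (component r) x y
  component-link⁺ {r = r} e x∈ = link-subgraph⁺ (reached? r) (componentLink? r)
    (e , ∈-subgraph⁻ (reached? r) (componentLink? r) x∈)

  component-link⁻ : Link (component r) x y → Removed Z a b x y × x ∈ⱽ component r
  component-link⁻ {r = r} e
    with f , s ← link-subgraph⁻ (reached? r) (componentLink? r) e =
    f , ∈-subgraph⁺ (reached? r) (componentLink? r) s

  component-step : Removed Z a b x y → x ∈ⱽ component r → y ∈ⱽ component r
  component-step e x∈ = ∈-component⁺ (∈-component⁻ x∈ ◅◅ e ◅ ε)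

module _ {Z : Subgraph n} (tZ : IsTreeGraph Z) {a b : Fin n} (e : Link Z a b) where

  removed-sym : Removed Z a b x y → Removed Z a b y x
  removed-sym (f , ne) = symmetric tZ f , (ne ∘ same-sym)

  component-isTreeGraph : ∀ r → IsTreeGraph (component Z a b r)
  component-isTreeGraph r = record
    { symmetric   = sym′
    ; irreflexive = λ f → irreflexive tZ (proj₁ (proj₁ (component-link⁻ Z a b f)))
    ; endpoint    = proj₂ ∘ component-link⁻ Z a b
    ; root        = r
    ; root∈       = ∈-component⁺ Z a b ε
    ; connected   = λ x∈ y∈ → Star.reverse sym′ (from-r x∈) ◅◅ from-r y∈
    ; bridges     = λ f s → bridges tZ (proj₁ (proj₁ (component-link⁻ Z a b f)))
        (Star.map (λ (g , ne) → proj₁ (proj₁ (component-link⁻ Z a b g)) , ne) s)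
    }
    where
    sym′ : Link (component Z a b r) x y → Link (component Z a b r) y x
    sym′ f with g , x∈ ← component-link⁻ Z a b f =
      component-link⁺ Z a b (removed-sym g) (component-step Z a b g x∈)
    walk : x ∈ⱽ component Z a b r → Star (Removed Z a b) x y →
           Star (Link (component Z a b r)) x y
    walk x∈ ε       = ε
    walk x∈ (g ◅ s) =
      component-link⁺ Z a b g x∈ ◅ walk (component-step Z a b g x∈) s
    from-r : x ∈ⱽ component Z a b r → Star (Link (component Z a b r)) r x
    from-r x∈ = walk (∈-component⁺ Z a b ε) (∈-component⁻ Z a b x∈)

  components-disjoint : Disjoint (component Z a b a) (component Z a b b)
  components-disjoint x∈ x∈′ = bridges tZ e
    (∈-component⁻ Z a b x∈ ◅◅ Star.reverse removed-sym (∈-component⁻ Z a b x∈′))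

  component⊑ : r ∈ⱽ Z → component Z a b r ⊑ Z
  component⊑ r∈ =
    (λ x∈ → closed (_∈ⱽ Z) (λ (f , _) _ → endpointʳ tZ f) (∈-component⁻ Z a b x∈) r∈) ,
    (proj₁ ∘ proj₁ ∘ component-link⁻ Z a b)

  components-cover : x ∈ⱽ Z → x ∈ⱽ component Z a b a ⊎ x ∈ⱽ component Z a b b
  components-cover x∈ = closed
    (λ x → x ∈ⱽ component Z a b a ⊎ x ∈ⱽ component Z a b b) extend
    (connected tZ (endpoint tZ e) x∈) (inj₁ (∈-component⁺ Z a b ε))
    where
    extend : Link Z x y → x ∈ⱽ component Z a b a ⊎ x ∈ⱽ component Z a b b →
             y ∈ⱽ component Z a b a ⊎ y ∈ⱽ component Z a b b
    extend {x} {y} f x∈ with same? a b x y | x∈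
    ... | yes (inj₁ (_ , refl)) | _        = inj₂ (∈-component⁺ Z a b ε)
    ... | yes (inj₂ (_ , refl)) | _        = inj₁ (∈-component⁺ Z a b ε)
    ... | no ne                 | inj₁ x∈a = inj₁ (component-step Z a b (f , ne) x∈a)
    ... | no ne                 | inj₂ x∈b = inj₂ (component-step Z a b (f , ne) x∈b)

  split-≡ : Z ≡ glue (component Z a b a) a b (component Z a b b)
  split-≡ = ⊑-antisym ((glue-∈⁺ ∘ components-cover) , (glue-link⁺ ∘ link))
    (glue-least (symmetric tZ) (component⊑ (endpoint tZ e)) (component⊑ (endpointʳ tZ e)) e)
    where
    link : Link Z x y → GlueLink (component Z a b a) a b (component Z a b b) x y
    link {x} {y} f with same? a b x y | components-cover (endpoint tZ f)
    ... | yes same | _        = inj₂ (inj₂ same)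
    ... | no ne    | inj₁ x∈a = inj₁ (component-link⁺ Z a b (f , ne) x∈a)
    ... | no ne    | inj₂ x∈b = inj₂ (inj₁ (component-link⁺ Z a b (f , ne) x∈b))

-- A view of a tree at an edge: matching on it replaces the tree by its glued form, and no equation
-- needs to be transported afterwards.
data Split (a b : Fin n) : Subgraph n → Set where
  split : IsTreeGraph X → IsTreeGraph Y → Disjoint X Y → a ∈ⱽ X → b ∈ⱽ Y →
          Split a b (glue X a b Y)

split-at : IsTreeGraph Z → Link Z a b → Split a b Z
split-at {Z = Z} {a} {b} tZ e = subst (Split a b) (sym (split-≡ tZ e))
  (split (component-isTreeGraph tZ e a) (component-isTreeGraph tZ e b)
         (λ {x} → components-disjoint tZ e {x})
         (∈-component⁺ Z a b ε) (∈-component⁺ Z a b ε))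

-- The only edge of the glued graph that leaves `X` joins `a` to `b`. As `Z` is connected and lacks
-- it, one common vertex traps `Z` in `X`.
confined : IsTreeGraph X → IsTreeGraph Y → Disjoint X Y → IsTreeGraph Z →
           Z ⊑ glue X a b Y → ¬ Link Z a b → x ∈ⱽ Z → x ∈ⱽ X → Z ⊑ X
confined {X = X} {Z = Z} tX tY X#Y tZ Z⊑K ¬e x∈Z x∈X = inside-X , link
  where
  step-link : Link Z y z → y ∈ⱽ X → Link X y z
  step-link f y∈ with glue-link⁻ (links⊑ Z⊑K f)
  ... | inj₁ g                           = g
  ... | inj₂ (inj₁ g)                    = contradiction (endpoint tY g) (X#Y y∈)
  ... | inj₂ (inj₂ (inj₁ (refl , refl))) = contradiction f ¬e
  ... | inj₂ (inj₂ (inj₂ (refl , refl))) = contradiction (symmetric tZ f) ¬e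
  inside-X : y ∈ⱽ Z → y ∈ⱽ X
  inside-X y∈ = closed (_∈ⱽ X) (λ f → endpointʳ tX ∘ step-link f) (connected tZ x∈Z y∈) x∈X
  link : Link Z y z → Link X y z
  link f = step-link f (inside-X (endpoint tZ f))

confinedʳ : IsTreeGraph X → IsTreeGraph Y → Disjoint X Y → IsTreeGraph Z →
            Z ⊑ glue X a b Y → ¬ Link Z a b → x ∈ⱽ Z → x ∈ⱽ Y → Z ⊑ Y
confinedʳ tX tY X#Y tZ Z⊑K ¬e =
  confined tY tX (flip X#Y) tZ (subst (_ ⊑_) glue-comm Z⊑K) (¬e ∘ symmetric tZ)

glue-mono : Z ⊑ X → W ⊑ Y → glue Z a b W ⊑ glue X a b Y
glue-mono Z⊑X W⊑Y =
  (glue-∈⁺ ∘ Sum.map (vertices⊑ Z⊑X) (vertices⊑ W⊑Y) ∘ glue-∈⁻) ,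
  (glue-link⁺ ∘ Sum.map (links⊑ Z⊑X) (Sum.map₁ (links⊑ W⊑Y)) ∘ glue-link⁻)

data SplitBelow (X : Subgraph n) (a b : Fin n) (Y : Subgraph n) : Subgraph n → Set where
  splitBelow : IsTreeGraph Z → IsTreeGraph W → Z ⊑ X → W ⊑ Y → a ∈ⱽ Z → b ∈ⱽ W →
               SplitBelow X a b Y (glue Z a b W)

-- Neither half of `Z` contains the edge between `a` and `b` again, since the ends lie in different
-- halves and these are disjoint. So `confined` applies to each half. This is the source of every
-- product in the counts.
split-below : IsTreeGraph X → IsTreeGraph Y → Disjoint X Y → a ∈ⱽ X → b ∈ⱽ Y →
              IsTreeGraph Z → Z ⊑ glue X a b Y → Link Z a b → SplitBelow X a b Y Z
split-below tX tY X#Y a∈X b∈Y tZ Z⊑K e with split-at tZ e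
... | split t₁ t₂ d a∈ b∈ = splitBelow t₁ t₂
  (confined tX tY X#Y t₁ (⊑-trans glue-⊑ˡ Z⊑K) (λ f → d (endpointʳ t₁ f) b∈) a∈ a∈X)
  (confinedʳ tX tY X#Y t₂ (⊑-trans glue-⊑ʳ Z⊑K) (λ f → d a∈ (endpoint t₂ f)) b∈ b∈Y)
  a∈ b∈

⊑-Disjoint : Z ⊑ X → W ⊑ Y → Disjoint X Y → Disjoint Z W
⊑-Disjoint Z⊑X W⊑Y X#Y x∈Z x∈W = X#Y (vertices⊑ Z⊑X x∈Z) (vertices⊑ W⊑Y x∈W)

-- `Z` is the trace of the glued graph on `X`: the other part lies in `Y`, and the joining edge has
-- its end `b` there.
glue-cancelˡ : IsTreeGraph X → IsTreeGraph Y → Disjoint X Y → b ∈ⱽ Y →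
               ∀ {Z Z′ W W′} → Z ⊑ X → W′ ⊑ Y → glue Z a b W ≡ glue Z′ a b W′ → Z ⊑ Z′
glue-cancelˡ {X = X} {b = b} {a = a} tX tY X#Y b∈ {Z} {Z′} {W} {W′} Z⊑X W′⊑Y eq = vs , ls
  where
  vs : x ∈ⱽ Z → x ∈ⱽ Z′
  vs x∈ with glue-∈⁻ (subst (_ ∈ⱽ_) eq (glue-∈⁺ (inj₁ x∈)))
  ... | inj₁ x∈Z′ = x∈Z′
  ... | inj₂ x∈W′ = contradiction (vertices⊑ W′⊑Y x∈W′) (X#Y (vertices⊑ Z⊑X x∈))
  ls : Link Z x y → Link Z′ x y
  ls {x} {y} e
    with links⊑ Z⊑X e | glue-link⁻ (subst (λ K → Link K x y) eq (glue-link⁺ (inj₁ e)))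
  ... | e′ | inj₁ f                        = f
  ... | e′ | inj₂ (inj₁ f)                 =
    contradiction (endpoint tY (links⊑ W′⊑Y f)) (X#Y (endpoint tX e′))
  ... | e′ | inj₂ (inj₂ (inj₁ (_ , refl))) = contradiction b∈ (X#Y (endpointʳ tX e′))
  ... | e′ | inj₂ (inj₂ (inj₂ (refl , _))) = contradiction b∈ (X#Y (endpoint tX e′))

glue-injective : IsTreeGraph X → IsTreeGraph Y → Disjoint X Y → a ∈ⱽ X → b ∈ⱽ Y →
                 ∀ {Z Z′ W W′} → Z ⊑ X → Z′ ⊑ X → W ⊑ Y → W′ ⊑ Y →
                 glue Z a b W ≡ glue Z′ a b W′ → Z ≡ Z′ × W ≡ W′
glue-injective tX tY X#Y a∈ b∈ Z⊑ Z′⊑ W⊑ W′⊑ eq =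
  ⊑-antisym (left Z⊑ W′⊑ eq) (left Z′⊑ W⊑ (sym eq)) ,
  ⊑-antisym (right W⊑ Z′⊑ (turn eq)) (right W′⊑ Z⊑ (turn (sym eq)))
  where
  turn : ∀ {Z Z′ W W′ : Subgraph n} {a b} →
         glue Z a b W ≡ glue Z′ a b W′ → glue W b a Z ≡ glue W′ b a Z′
  turn eq = trans glue-comm (trans eq glue-comm)
  left  = glue-cancelˡ tX tY X#Y b∈
  right = glue-cancelˡ tY tX (flip X#Y) a∈

-- Lists of subtrees

glueAll : Fin n → Fin n → List (Subgraph n) → List (Subgraph n) → List (Subgraph n)
glueAll a b = cartesianProductWith λ Z W → glue Z a b W

total : List (Subgraph n) → ℕ
total L = sum (map order L)

total-++ : (L K : List (Subgraph n)) → total (L ++ K) ≡ total L + total K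
total-++ L K = trans (cong sum (map-++ order L K)) (sum-++ (map order L) (map order K))

module _ {X Y : Subgraph n} (X#Y : Disjoint X Y) {K : List (Subgraph n)} (K⊑Y : All (_⊑ Y) K)
         {a b : Fin n} where

  length-glueAll : ∀ L → length (glueAll a b L K) ≡ length L * length K
  length-glueAll []      = refl
  length-glueAll (Z ∷ L) = trans (length-++ (map (λ W → glue Z a b W) K))
    (cong₂ _+_ (length-map _ K) (length-glueAll L))

  total-map-glue : Z ⊑ X → ∀ {K} → All (_⊑ Y) K →
                   total (map (λ W → glue Z a b W) K) ≡ order Z * length K + total K
  total-map-glue {Z} Z⊑X [] = solve 1 (λ o → con 0 := o :* con 0 :+ con 0) refl (order Z)
  total-map-glue {Z} Z⊑X {W ∷ K} (W⊑Y ∷ K⊑Y)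
    rewrite order-glue {a = a} {b = b} (⊑-Disjoint Z⊑X W⊑Y X#Y) | total-map-glue Z⊑X K⊑Y =
    solve 4 (λ z w l t → z :+ w :+ (z :* l :+ t) := z :* (con 1 :+ l) :+ (w :+ t))
      refl (order Z) (order W) (length K) (total K)

  total-glueAll : ∀ {L} → All (_⊑ X) L →
                  total (glueAll a b L K) ≡ total L * length K + length L * total K
  total-glueAll [] = refl
  total-glueAll {Z ∷ L} (Z⊑X ∷ L⊑X)
    rewrite total-++ (map (λ W → glue Z a b W) K) (glueAll a b L K)
          | total-map-glue Z⊑X K⊑Y | total-glueAll L⊑X =
    solve 5 (λ z k t l s → z :* k :+ t :+ (s :* k :+ l :* t)
                        := (z :+ s) :* k :+ (t :+ l :* t))
      refl (order Z) (length K) (total K) (length L) (total L)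

module _ (tX : IsTreeGraph X) (tY : IsTreeGraph Y) (X#Y : Disjoint X Y)
         (a∈X : a ∈ⱽ X) (b∈Y : b ∈ⱽ Y) where

  private
    inj : ∀ {Z Z′ W W′} → Z ⊑ X → Z′ ⊑ X → W ⊑ Y → W′ ⊑ Y →
          glue Z a b W ≡ glue Z′ a b W′ → Z ≡ Z′ × W ≡ W′
    inj = glue-injective tX tY X#Y a∈X b∈Y

  map-glue-unique : Z ⊑ X → ∀ {K} → Unique K → All (_⊑ Y) K →
                    Unique (map (λ W → glue Z a b W) K)
  map-glue-unique {Z = Z} Z⊑X K! K⊑Y = AllPairs.map⁺ (distinct K! K⊑Y)
    where
    distinct : ∀ {K} → Unique K → All (_⊑ Y) K →
               AllPairs (λ W W′ → glue Z a b W ≢ glue Z a b W′) K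
    distinct []        []          = []
    distinct (W∉ ∷ K!) (W⊑ ∷ K⊑) =
      All.zipWith (λ (W≢ , W′⊑) eq → W≢ (proj₂ (inj Z⊑X Z⊑X W⊑ W′⊑ eq))) (W∉ , K⊑)
        ∷ distinct K! K⊑

  glueAll-unique : ∀ {L K} → Unique L → All (_⊑ X) L → Unique K → All (_⊑ Y) K →
                   Unique (glueAll a b L K)
  glueAll-unique []        []        K! K⊑ = []
  glueAll-unique {Z ∷ L} {K} (Z∉ ∷ L!) (Z⊑ ∷ L⊑) K! K⊑ =
    Unique.++⁺ (map-glue-unique Z⊑ K! K⊑) (glueAll-unique L! L⊑ K! K⊑) different
    where
    different : ∀ {V} → ¬ (V ∈ᴸ map (λ W → glue Z a b W) K × V ∈ᴸ glueAll a b L K)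
    different (V∈₁ , V∈₂)
      with W , W∈ , refl ← ∈-map⁻ _ V∈₁
         | Z′ , W′ , Z′∈ , W′∈ , eq ← ∈-cartesianProductWith⁻ _ L K V∈₂ =
      All.lookup Z∉ Z′∈
        (proj₁ (inj Z⊑ (All.lookup L⊑ Z′∈) (All.lookup K⊑ W∈) (All.lookup K⊑ W′∈) eq))

-- Rooted trees built by attaching a branch to the root

-- Branches are attached to the root one at a time, so that a vertex with many children needs no
-- list of subtrees of its own and every recurrence involves just two smaller rooted trees.
data Build {n} : Subgraph n → Fin n → Set where
  singleton : ∀ r → Build (single r) r
  attach : Build X r → Build Y c → Disjoint X Y → Build (glue X r c Y) r

build-root : Build X r → r ∈ⱽ X
build-root (singleton r)     = ∈-single⁺
build-root (attach t _ _) = glue-∈⁺ (inj₁ (build-root t))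

build-isTreeGraph : Build X r → IsTreeGraph X
build-isTreeGraph (singleton r)       = single-isTreeGraph r
build-isTreeGraph (attach t s X#Y) =
  glue-isTreeGraph (build-isTreeGraph t) (build-isTreeGraph s) X#Y (build-root t) (build-root s)

-- A subtree through `r` either lacks the edge to `c` and stays in `X`, or is an independent pair of
-- a subtree through `r` and a subtree of the branch through `c`.
rooted : {X : Subgraph n} → Build X r → List (Subgraph n)
rooted (singleton r)                   = single r ∷ []
rooted (attach {r = r} {c = c} t s _) = rooted t ++ glueAll r c (rooted t) (rooted s)

others : {X : Subgraph n} → Build X r → List (Subgraph n)
others (singleton r)     = []
others (attach t s _) = others t ++ (rooted s ++ others s)

rooted-sound : (t : Build X r) → Z ∈ᴸ rooted t → IsTreeGraph Z × Z ⊑ X × r ∈ⱽ Z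
rooted-sound (singleton r) (here refl) = single-isTreeGraph r , ⊑-refl , ∈-single⁺
rooted-sound (attach t s X#Y) Z∈ with ∈-++⁻ (rooted t) Z∈
... | inj₁ Z∈t = let tZ , Z⊑X , r∈Z = rooted-sound t Z∈t in tZ , ⊑-trans Z⊑X glue-⊑ˡ , r∈Z
... | inj₂ Z∈ts
  with _ , _ , Z₁∈ , Z₂∈ , refl ← ∈-cartesianProductWith⁻ _ (rooted t) (rooted s) Z∈ts
  with t₁ , Z₁⊑X , r∈ ← rooted-sound t Z₁∈ | t₂ , Z₂⊑Y , c∈ ← rooted-sound s Z₂∈ =
  glue-isTreeGraph t₁ t₂ (⊑-Disjoint Z₁⊑X Z₂⊑Y X#Y) r∈ c∈ ,
  glue-mono Z₁⊑X Z₂⊑Y , glue-∈⁺ (inj₁ r∈)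

rooted⊑ : (t : Build X r) → All (_⊑ X) (rooted t)
rooted⊑ t = All.tabulate λ Z∈ → proj₁ (proj₂ (rooted-sound t Z∈))

others-sound : (t : Build X r) → Z ∈ᴸ others t → IsTreeGraph Z × Z ⊑ X × r ∉ⱽ Z
others-sound (attach t s X#Y) Z∈ with ∈-++⁻ (others t) Z∈
... | inj₁ Z∈t = let tZ , Z⊑X , r∉Z = others-sound t Z∈t in tZ , ⊑-trans Z⊑X glue-⊑ˡ , r∉Z
... | inj₂ Z∈s with ∈-++⁻ (rooted s) Z∈s
...   | inj₁ Z∈r = let tZ , Z⊑Y , _ = rooted-sound s Z∈r in
        tZ , ⊑-trans Z⊑Y glue-⊑ʳ , (X#Y (build-root t) ∘ vertices⊑ Z⊑Y)
...   | inj₂ Z∈o = let tZ , Z⊑Y , _ = others-sound s Z∈o in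
        tZ , ⊑-trans Z⊑Y glue-⊑ʳ , (X#Y (build-root t) ∘ vertices⊑ Z⊑Y)

rooted-complete : (t : Build X r) → IsTreeGraph Z → Z ⊑ X → r ∈ⱽ Z → Z ∈ᴸ rooted t
rooted-complete (singleton r) tZ Z⊑X r∈ =
  here (isolated⇒single tZ r∈ (¬link-single ∘ links⊑ Z⊑X))
rooted-complete {Z = Z} (attach {r = r} {c = c} t s X#Y) tZ Z⊑K r∈ with link? Z r c
... | no ¬e = ∈-++⁺ˡ (rooted-complete t tZ
        (confined (build-isTreeGraph t) (build-isTreeGraph s) X#Y tZ Z⊑K ¬e r∈ (build-root t)) r∈)
... | yes e with split-below (build-isTreeGraph t) (build-isTreeGraph s) X#Y
                             (build-root t) (build-root s) tZ Z⊑K e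
...   | splitBelow t₁ t₂ Z₁⊑X Z₂⊑Y r∈₁ c∈₂ = ∈-++⁺ʳ (rooted t)
        (∈-cartesianProductWith⁺ _ (rooted-complete t t₁ Z₁⊑X r∈₁)
                                   (rooted-complete s t₂ Z₂⊑Y c∈₂))

others-complete : (t : Build X r) → IsTreeGraph Z → Z ⊑ X → r ∉ⱽ Z → Z ∈ᴸ others t
others-complete (singleton r) tZ Z⊑X r∉ =
  contradiction (subst (_∈ⱽ _) (∈-single⁻ (vertices⊑ Z⊑X (root∈ tZ))) (root∈ tZ)) r∉
others-complete {Z = Z} (attach {r = r} {c = c} t s X#Y) tZ Z⊑K r∉
  with glue-∈⁻ (vertices⊑ Z⊑K (root∈ tZ))
... | inj₁ x∈X = ∈-++⁺ˡ (others-complete t tZ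
        (confined (build-isTreeGraph t) (build-isTreeGraph s) X#Y tZ Z⊑K
                  (r∉ ∘ endpoint tZ) (root∈ tZ) x∈X) r∉)
... | inj₂ x∈Y with confinedʳ (build-isTreeGraph t) (build-isTreeGraph s) X#Y tZ Z⊑K
                              (r∉ ∘ endpoint tZ) (root∈ tZ) x∈Y | c ∈ⱽ? Z
...   | Z⊑Y | yes c∈ = ∈-++⁺ʳ (others t) (∈-++⁺ˡ (rooted-complete s tZ Z⊑Y c∈))
...   | Z⊑Y | no  c∉ = ∈-++⁺ʳ (others t) (∈-++⁺ʳ (rooted s) (others-complete s tZ Z⊑Y c∉))

rooted-unique : (t : Build X r) → Unique (rooted t)
rooted-unique (singleton r) = [] ∷ []
rooted-unique (attach {r = r} {c = c} t s X#Y) = Unique.++⁺ (rooted-unique t)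
  (glueAll-unique (build-isTreeGraph t) (build-isTreeGraph s) X#Y (build-root t) (build-root s)
    (rooted-unique t) (rooted⊑ t) (rooted-unique s) (rooted⊑ s))
  λ (Z∈₁ , Z∈₂) → different Z∈₁ Z∈₂
  where
  different : Z ∈ᴸ rooted t → ¬ Z ∈ᴸ glueAll r c (rooted t) (rooted s)
  different Z∈₁ Z∈₂
    with _ , Z⊑X , _ ← rooted-sound t Z∈₁
       | _ , _ , _ , W∈ , refl ← ∈-cartesianProductWith⁻ _ (rooted t) (rooted s) Z∈₂
    with _ , _ , c∈ ← rooted-sound s W∈ =
    X#Y (vertices⊑ Z⊑X (glue-∈⁺ (inj₂ c∈))) (build-root s)

others-unique : (t : Build X r) → Unique (others t)
others-unique (singleton r) = []
others-unique (attach {Y = Y} t s X#Y) = Unique.++⁺ (others-unique t)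
  (Unique.++⁺ (rooted-unique s) (others-unique s)
    λ (Z∈₁ , Z∈₂) → proj₂ (proj₂ (others-sound s Z∈₂)) (proj₂ (proj₂ (rooted-sound s Z∈₁))))
  λ (Z∈₁ , Z∈₂) → different Z∈₁ Z∈₂
  where
  below : Z ∈ᴸ rooted s ++ others s → Z ⊑ Y
  below Z∈ with ∈-++⁻ (rooted s) Z∈
  ... | inj₁ Z∈r = proj₁ (proj₂ (rooted-sound s Z∈r))
  ... | inj₂ Z∈o = proj₁ (proj₂ (others-sound s Z∈o))
  different : Z ∈ᴸ others t → ¬ Z ∈ᴸ rooted s ++ others s
  different Z∈₁ Z∈₂ with tZ , Z⊑X , _ ← others-sound t Z∈₁ =
    X#Y (vertices⊑ Z⊑X (root∈ tZ)) (vertices⊑ (below Z∈₂) (root∈ tZ))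

all-subtrees : {X : Subgraph n} → Build X r → List (Subgraph n)
all-subtrees t = rooted t ++ others t

all-sound : (t : Build X r) → Z ∈ᴸ all-subtrees t → IsTreeGraph Z × Z ⊑ X
all-sound t Z∈ with ∈-++⁻ (rooted t) Z∈
... | inj₁ Z∈r = let tZ , Z⊑X , _ = rooted-sound t Z∈r in tZ , Z⊑X
... | inj₂ Z∈o = let tZ , Z⊑X , _ = others-sound t Z∈o in tZ , Z⊑X

all-complete : (t : Build X r) → IsTreeGraph Z → Z ⊑ X → Z ∈ᴸ all-subtrees t
all-complete {r = r} {Z = Z} t tZ Z⊑X with r ∈ⱽ? Z
... | yes r∈ = ∈-++⁺ˡ (rooted-complete t tZ Z⊑X r∈)
... | no  r∉ = ∈-++⁺ʳ (rooted t) (others-complete t tZ Z⊑X r∉)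

all-unique : (t : Build X r) → Unique (all-subtrees t)
all-unique t = Unique.++⁺ (rooted-unique t) (others-unique t)
  λ (Z∈₁ , Z∈₂) → proj₂ (proj₂ (others-sound t Z∈₂)) (proj₂ (proj₂ (rooted-sound t Z∈₁)))

-- Any neighbour of the root can serve as the root of the last branch. Cutting there makes both
-- halves smaller, because the opposite half contains its own end of the cut edge.
build : IsTreeGraph X → r ∈ⱽ X → Build X r
build tX r∈ = go (<-wellFounded _) tX r∈
  where
  go : Acc _<_ (order X) → IsTreeGraph X → r ∈ⱽ X → Build X r
  go {X = X} {r = r} (acc smaller) tX r∈ with any? (link? X r)
  ... | no isolated = subst (λ X → Build X r)
          (sym (isolated⇒single tX r∈ λ e → isolated (_ , e))) (singleton r)
  ... | yes (c , e) with split-at tX e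
  ...   | split {X = X₁} {Y = Y₁} t₁ t₂ d r∈₁ c∈₂ = attach
    (go (smaller (subst (order X₁ <_) (sym (order-glue d)) (m<m+n (order X₁) (1≤order c∈₂))))
        t₁ r∈₁)
    (go (smaller (subst (order Y₁ <_) (sym (order-glue d)) (m<n+m (order Y₁) (1≤order r∈₁))))
        t₂ c∈₂)
    d

-- Leaves

IsLeaf : Subgraph n → Fin n → Fin n → Set
IsLeaf X u w = Link X w u × (∀ {x} → Link X u x → x ≡ w)

-- Demanding `u ≢ r` makes the induction work: gluing a branch on gives a new neighbour, within the
-- branch, only to its root `c`, so a leaf of the branch other than `c` remains a leaf. If the
-- branch is a single vertex, that vertex is the leaf.
find-leaf : Build X r → X ≡ single r ⊎ ∃₂ λ u w → u ≢ r × IsLeaf X u w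
find-leaf (singleton r) = inj₁ refl
find-leaf (attach {X = X} {r = r} {Y = Y} {c = c} t s X#Y) with find-leaf s
... | inj₁ refl = inj₂ (c , r , c≢r , glue-bridge , only)
  where
  c≢r : c ≢ r
  c≢r refl = X#Y (build-root t) (build-root s)
  only : Link (glue X r c Y) c x → x ≡ r
  only e with glue-link⁻ e
  ... | inj₁ f = contradiction (build-root s) (X#Y (endpoint (build-isTreeGraph t) f))
  ... | inj₂ (inj₁ f) = contradiction f ¬link-single
  ... | inj₂ (inj₂ (inj₁ (c≡r , _))) = contradiction c≡r c≢r
  ... | inj₂ (inj₂ (inj₂ (_ , x≡r))) = x≡r
... | inj₂ (u , w , u≢c , e , leaf) =
  inj₂ (u , w , u≢r , links⊑ glue-⊑ʳ e , only)
  where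
  u∈ : u ∈ⱽ Y
  u∈ = endpointʳ (build-isTreeGraph s) e
  u≢r : u ≢ r
  u≢r refl = X#Y (build-root t) u∈
  only : Link (glue X r c Y) u x → x ≡ w
  only e with glue-link⁻ e
  ... | inj₁ f = contradiction u∈ (X#Y (endpoint (build-isTreeGraph t) f))
  ... | inj₂ (inj₁ f) = leaf f
  ... | inj₂ (inj₂ (inj₁ (u≡r , _))) = contradiction u≡r u≢r
  ... | inj₂ (inj₂ (inj₂ (u≡c , _))) = contradiction u≡c u≢c

-- Counting

-- The hypotheses bound the left side by F² + F²F′ + FF′². The right side is F² + 2F²F′ + F²F′²,
-- where F ≥ 1 takes care of the last term.
branch-inequality : ∀ {F} D F′ D′ → 1 ≤ F → D ≤ F * F → D′ ≤ F′ * F′ →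
                    D + (D * F′ + F * D′) ≤ (F + F * F′) * (F + F * F′)
branch-inequality {suc f} D F′ D′ _ D≤ D′≤ = begin
  D + (D * F′ + F * D′)
    ≤⟨ +-mono-≤ D≤ (+-mono-≤ (*-monoˡ-≤ F′ D≤) (*-monoʳ-≤ F D′≤)) ⟩
  F * F + (F * F * F′ + F * (F′ * F′))         ≤⟨ m≤m+n _ _ ⟩
  F * F + (F * F * F′ + F * (F′ * F′)) + (F * F * F′ + f * F * (F′ * F′))
    ≡⟨ solve 2 (λ f g → let h = con 1 :+ f in
         h :* h :+ (h :* h :* g :+ h :* (g :* g)) :+ (h :* h :* g :+ f :* h :* (g :* g))
         := (h :+ h :* g) :* (h :+ h :* g)) refl f F′ ⟩
  (F + F * F′) * (F + F * F′)                  ∎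
  where
  open ≤-Reasoning
  F = suc f

-- F and D (R and Q) are the number and the total order of the subtrees containing
-- (avoiding) the root; primes refer to the branch attached to it.
branch-mean-inequality : ∀ {F D R Q F′ D′ R′ Q′} → F ≤ D → 1 ≤ F′ → D′ ≤ F′ * F′ →
  Q * F ≤ D * R → Q′ * F′ ≤ D′ * R′ →
  (Q + (D′ + Q′)) * (F + F * F′) ≤ (D + (D * F′ + F * D′)) * (R + (F′ + R′))
branch-mean-inequality {F} {D} {R} {Q} {F′@(suc _)} {D′} {R′} {Q′} F≤D _ D′≤ QF≤DR QF≤DR′
  -- Writing `D` as `F + E` removes all subtraction: the slack in the last estimate becomes a
  -- polynomial with natural coefficients.
  with E , refl ← m≤n⇒∃[o]m+o≡n F≤D = begin
  (Q + M) * (F + F * F′)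
    ≡⟨ solve 4 (λ q m f g → (q :+ m) :* (f :+ f :* g)
                         := q :* f :* (con 1 :+ g) :+ f :* (m :+ m :* g)) refl Q M F F′ ⟩
  Q * F * (1 + F′) + F * (M + M * F′)
    ≤⟨ +-mono-≤ (*-monoˡ-≤ (1 + F′) QF≤DR) (*-monoʳ-≤ F (+-mono-≤ M≤F′N MF′≤D′N)) ⟩
  (F + E) * R * (1 + F′) + F * (F′ * N + D′ * N)
    ≤⟨ m≤m+n _ _ ⟩
  (F + E) * R * (1 + F′) + F * (F′ * N + D′ * N) + (F * D′ * R + F * N + E * (1 + F′) * N)
    ≡⟨ solve 6 (λ f e r g d n →
         (f :+ e) :* r :* (con 1 :+ g) :+ f :* (g :* n :+ d :* n)
           :+ (f :* d :* r :+ f :* n :+ e :* (con 1 :+ g) :* n)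
         := ((f :+ e) :+ ((f :+ e) :* g :+ f :* d)) :* (r :+ n)) refl F E R F′ D′ N ⟩
  ((F + E) + ((F + E) * F′ + F * D′)) * (R + N) ∎
  where
  open ≤-Reasoning
  M = D′ + Q′
  N = F′ + R′
  MF′≤D′N : M * F′ ≤ D′ * N
  MF′≤D′N = begin
    (D′ + Q′) * F′     ≡⟨ *-distribʳ-+ F′ D′ Q′ ⟩
    D′ * F′ + Q′ * F′  ≤⟨ +-monoʳ-≤ (D′ * F′) QF≤DR′ ⟩
    D′ * F′ + D′ * R′  ≡⟨ *-distribˡ-+ D′ F′ R′ ⟨
    D′ * N             ∎
  -- `M` and `N` belong to all subtrees of the branch. Their mean is at most the mean at the root of
  -- the branch, which is at most `F′`.
  M≤F′N : M ≤ F′ * N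
  M≤F′N = *-cancelʳ-≤ M (F′ * N) F′ (begin
    M * F′        ≤⟨ MF′≤D′N ⟩
    D′ * N        ≤⟨ *-monoˡ-≤ N D′≤ ⟩
    F′ * F′ * N   ≡⟨ solve 2 (λ g n → g :* g :* n := g :* n :* g) refl F′ N ⟩
    F′ * N * F′   ∎)

-- Recurrences for numbers and total orders

module _ (t : Build X r) (s : Build Y c) (X#Y : Disjoint X Y) where

  length-rooted : length (rooted (attach t s X#Y)) ≡
                  length (rooted t) + length (rooted t) * length (rooted s)
  length-rooted = trans (length-++ (rooted t))
    (cong (length (rooted t) +_) (length-glueAll X#Y (rooted⊑ s) (rooted t)))

  total-rooted : total (rooted (attach t s X#Y)) ≡
                 total (rooted t) + (total (rooted t) * length (rooted s)
                                   + length (rooted t) * total (rooted s))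
  total-rooted = trans (total-++ (rooted t) _)
    (cong (total (rooted t) +_) (total-glueAll X#Y (rooted⊑ s) (rooted⊑ t)))

  length-others : length (others (attach t s X#Y)) ≡
                  length (others t) + (length (rooted s) + length (others s))
  length-others = trans (length-++ (others t))
    (cong (length (others t) +_) (length-++ (rooted s)))

  total-others : total (others (attach t s X#Y)) ≡
                 total (others t) + (total (rooted s) + total (others s))
  total-others = trans (total-++ (others t) _)
    (cong (total (others t) +_) (total-++ (rooted s) (others s)))

total-rooted-singleton : (r : Fin n) → total (rooted (singleton r)) ≡ 1
total-rooted-singleton r = cong (_+ 0) (order-single r)

1≤length-rooted : (t : Build X r) → 1 ≤ length (rooted t)
1≤length-rooted (singleton r)    = s≤s z≤n
1≤length-rooted (attach t s X#Y) rewrite length-rooted t s X#Y =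
  ≤-trans (1≤length-rooted t) (m≤m+n _ _)

length≤total-rooted : (t : Build X r) → length (rooted t) ≤ total (rooted t)
length≤total-rooted (singleton r) = ≤-reflexive (sym (total-rooted-singleton r))
length≤total-rooted (attach t s X#Y)
  rewrite length-rooted t s X#Y | total-rooted t s X#Y =
  +-mono-≤ (length≤total-rooted t)
    (≤-trans (*-monoˡ-≤ (length (rooted s)) (length≤total-rooted t)) (m≤m+n _ _))

-- Behind this stands that the paths from the root to the vertices are distinct subtrees, so their
-- number is at least the order of `X` and hence at least the mean. The induction reaches the bound
-- without mentioning paths.
total≤length²-rooted : (t : Build X r) →
                       total (rooted t) ≤ length (rooted t) * length (rooted t)
total≤length²-rooted (singleton r) = ≤-reflexive (total-rooted-singleton r)
total≤length²-rooted (attach t s X#Y)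
  rewrite length-rooted t s X#Y | total-rooted t s X#Y =
  branch-inequality (total (rooted t)) (length (rooted s)) (total (rooted s))
    (1≤length-rooted t) (total≤length²-rooted t) (total≤length²-rooted s)

-- Jamison's inequality in the form that the induction can carry: the mean over all subtrees is a
-- weighted average of the two means compared here. Cross-multiplication admits the single vertex,
-- where no subtree avoids the root.
others-mean≤rooted-mean : (t : Build X r) →
  total (others t) * length (rooted t) ≤ total (rooted t) * length (others t)
others-mean≤rooted-mean (singleton r) = z≤n
others-mean≤rooted-mean (attach t s X#Y)
  rewrite length-rooted t s X#Y | total-rooted t s X#Y
        | length-others t s X#Y | total-others t s X#Y =
  branch-mean-inequality {F = length (rooted t)} {R = length (others t)}
    {Q = total (others t)} {R′ = length (others s)} {Q′ = total (others s)}
    (length≤total-rooted t) (1≤length-rooted s) (total≤length²-rooted s)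
    (others-mean≤rooted-mean t) (others-mean≤rooted-mean s)

-- Jamison: the local mean subtree order is at least the global one.
mean≤rooted-mean : (t : Build X r) →
  total (all-subtrees t) * length (rooted t) ≤ total (rooted t) * length (all-subtrees t)
mean≤rooted-mean t rewrite length-++ (rooted t) {others t} | total-++ (rooted t) (others t) =
  begin
  (D + Q) * F     ≡⟨ *-distribʳ-+ F D Q ⟩
  D * F + Q * F   ≤⟨ +-monoʳ-≤ (D * F) (others-mean≤rooted-mean t) ⟩
  D * F + D * R   ≡⟨ *-distribˡ-+ D F R ⟨
  D * (F + R)     ∎
  where
  open ≤-Reasoning
  F = length (rooted t)
  D = total (rooted t)
  R = length (others t)
  Q = total (others t)

-- F₁ and D₁ (F₂ and D₂) are the number and the total order of the subtrees
-- through w (through v) of the tree made of the branches at w and v. The factors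
-- 1 are the number and the total order of the subtrees of the single vertex u.
extension-inequality : ∀ {a b} A B → 1 ≤ a → 1 ≤ b → A ≤ a * a →
  let F₁ = a + a * b ; D₁ = A + (A * b + a * B)
      F₂ = b + b * a ; D₂ = B + (B * a + b * A) in
  (D₁ + (D₁ * 1 + F₁ * 1)) * (1 * F₂ + a * 1 * b) <
  ((1 * F₂ + 1 * D₂) + ((A * 1 + a * 1) * b + a * 1 * B)) * (F₁ + F₁ * 1)
extension-inequality {suc α′} {suc β′} A B _ _ A≤ =
  -- The new mean is 1 + B/b + 2A/(1 + 2a), the mean at w is 1/2 + A/a + B/(1 + b). Over the common
  -- denominator 2a(1 + b)b(1 + 2a) the difference has the numerator ab(1 + b)(1 + 2a) + 2a(1 + 2a)B
  -- - 2b(1 + b)A. The negative term is added to both sides and bounded by A ≤ a², which leaves at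
  -- least ab(1 + b) > 0.
  +-cancelʳ-< (2 * β * (1 + β) * A) _ _ (begin-strict
  old + 2 * β * (1 + β) * A
    ≤⟨ +-monoʳ-≤ old (*-monoʳ-≤ (2 * β * (1 + β)) A≤) ⟩
  old + 2 * β * (1 + β) * (α * α)
    <⟨ m<m+n _ {α * β * (1 + β)} (s≤s z≤n) ⟩
  old + 2 * β * (1 + β) * (α * α) + α * β * (1 + β)
    ≤⟨ m≤m+n _ (2 * α * (1 + 2 * α) * B) ⟩
  old + 2 * β * (1 + β) * (α * α) + α * β * (1 + β) + 2 * α * (1 + 2 * α) * B
    ≡⟨ solve 4 (λ a b A B →
         let F₁ = a :+ a :* b
             D₁ = A :+ (A :* b :+ a :* B)
             F₂ = b :+ b :* a
             D₂ = B :+ (B :* a :+ b :* A)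
             i = con 1
             ii = con 2
         in
         (D₁ :+ (D₁ :* i :+ F₁ :* i)) :* (i :* F₂ :+ a :* i :* b)
           :+ ii :* b :* (i :+ b) :* (a :* a) :+ a :* b :* (i :+ b)
           :+ ii :* a :* (i :+ ii :* a) :* B
         := ((i :* F₂ :+ i :* D₂) :+ ((A :* i :+ a :* i) :* b :+ a :* i :* B))
              :* (F₁ :+ F₁ :* i)
           :+ ii :* b :* (i :+ b) :* A) refl α β A B ⟩
  _ ∎)
  where
  open ≤-Reasoning
  α = suc α′
  β = suc β′
  F₁ = α + α * β
  D₁ = A + (A * β + α * B)
  F₂ = β + β * α
  old = (D₁ + (D₁ * 1 + F₁ * 1)) * (1 * F₂ + α * 1 * β)

-- From M/N ≤ D/F < M′/N′ it follows that the mediant of M/N and M′/N′ exceeds M/N. The middle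
-- fraction is eliminated by multiplying with `F` and cancelling it.
mean-increases : ∀ {M N D F M′ N′} → 1 ≤ N → M * F ≤ D * N → D * N′ < M′ * F →
                 M * (N + N′) < (M + M′) * N
mean-increases {M} {N@(suc _)} {D} {F} {M′} {N′} _ MF≤DN DN′<M′F = begin-strict
  M * (N + N′)     ≡⟨ *-distribˡ-+ M N N′ ⟩
  M * N + M * N′   <⟨ +-monoʳ-< (M * N) (*-cancelʳ-< F _ _ (begin-strict
    M * N′ * F       ≡⟨ swap-last M N′ F ⟩
    M * F * N′       ≤⟨ *-monoˡ-≤ N′ MF≤DN ⟩
    D * N * N′       ≡⟨ swap-last D N N′ ⟩
    D * N′ * N       <⟨ *-monoˡ-< N DN′<M′F ⟩
    M′ * F * N       ≡⟨ swap-last M′ F N ⟩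
    M′ * N * F       ∎)) ⟩
  M * N + M′ * N   ≡⟨ *-distribʳ-+ N M M′ ⟨
  (M + M′) * N     ∎
  where
  open ≤-Reasoning
  swap-last : ∀ x y z → x * y * z ≡ x * z * y
  swap-last = solve 3 (λ x y z → x :* y :* z := x :* z :* y) refl

-- From counts to mean subtree orders

/-mono-< : ∀ p q s t .{{_ : NonZero q}} .{{_ : NonZero t}} →
           p * t < s * q → ℤ.+ p / q ℚ.< ℤ.+ s / t
/-mono-< p (suc q) s (suc t) pt<sq = ℚ.toℚᵘ-cancel-<
  (ℚᵘ.<-respˡ-≃ (ℚᵘ.≃-sym (ℚ.toℚᵘ-fromℚᵘ (mkℚᵘ (ℤ.+ p) q)))
    (ℚᵘ.<-respʳ-≃ (ℚᵘ.≃-sym (ℚ.toℚᵘ-fromℚᵘ (mkℚᵘ (ℤ.+ s) t)))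
      (*<* (subst₂ ℤ._<_ (ℤ.pos-* p (suc t)) (ℤ.pos-* s (suc q)) (ℤ.+<+ pt<sq)))))

μ-< : (G H : Graph n) .{{_ : NonZero n}} {L K : List (Subgraph n)} →
      subtrees G ↭ L → subtrees H ↭ K →
      total L * length K < total K * length L → μ H > μ G
μ-< G H G↭L H↭K lt = /-mono-< (eval (derivative (S G)) 1) (eval (S G) 1)
  (eval (derivative (S H)) 1) (eval (S H) 1) {{S[1]-nonZero G}} {{S[1]-nonZero H}}
  (subst₂ _<_ (cong₂ _*_ (total-≡ G G↭L) (length-≡ H H↭K))
              (cong₂ _*_ (total-≡ H H↭K) (length-≡ G G↭L)) lt)
  where
  length-≡ : ∀ {L} (G : Graph _) → subtrees G ↭ L → length L ≡ eval (S G) 1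
  length-≡ G G↭L = sym (trans (S[1]≡number G) (↭-length G↭L))
  total-≡ : ∀ {L} (G : Graph _) → subtrees G ↭ L → total L ≡ eval (derivative (S G)) 1
  total-≡ G G↭L = sym (trans (S′[1]≡total-order G) (sum-↭ (↭-map⁺ order G↭L)))

-- The whole graph as a subgraph

opaque
  unfolding _∈ⱽ_ Link

  whole : Graph n → Subgraph n
  whole G = ⊤ , edges G

  link-whole⁺ : {G : Graph n} → u ~[ G ] v → Link (whole G) u v
  link-whole⁺ e = e

  link-whole⁻ : {G : Graph n} → Link (whole G) u v → u ~[ G ] v
  link-whole⁻ e = e

  whole-isTreeGraph : {G : Graph n} → Tree G → IsTreeGraph (whole G)
  whole-isTreeGraph {G = G} tG =
    isSubtree⇒isTreeGraph {G = G} (isSubtree (isGraph⊤ G) (λ e → e) tG)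

  order-whole : (G : Graph n) → order (whole G) ≡ n
  order-whole _ = ∣⊤∣≡n _

  subtree⊑whole : {G : Graph n} → IsSubtree G X → X ⊑ whole G
  subtree⊑whole s = (λ _ → ∈⊤) , IsSubtree.included s

  subtree-join⁻ : {G : Graph n} (a≢b : a ≢ b) → IsSubtree (join G a≢b) X →
                  ∀ {x y} → Link X x y → Link (whole G) x y ⊎ Same a b x y
  subtree-join⁻ {G = G} a≢b s e = fromDec⁻ (joinAdj? G a≢b) (IsSubtree.included s e)

  subtree-join⁺ : {G : Graph n} (a≢b : a ≢ b) → IsTreeGraph X →
                  (∀ {x y} → Link X x y → Link (whole G) x y ⊎ Same a b x y) →
                  IsSubtree (join G a≢b) X
  subtree-join⁺ {G = G} a≢b tX link =
    isTreeGraph⇒isSubtree {G = join G a≢b} tX (fromDec⁺ (joinAdj? G a≢b) ∘ link)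

  ∈-whole : {G : Graph n} → x ∈ⱽ whole G
  ∈-whole = ∈⊤

unique∧set⇒↭ : ∀ {A : Set} {xs ys : List A} → Unique xs → Unique ys →
               (∀ {x} → x ∈ᴸ xs → x ∈ᴸ ys) → (∀ {x} → x ∈ᴸ ys → x ∈ᴸ xs) → xs ↭ ys
unique∧set⇒↭ xs! ys! to from = ∼bag⇒↭ (unique∧set⇒bag xs! ys! (mk⇔ to from))

subtrees↭all : {G : Graph n} (t : Build X r) → whole G ≡ X → subtrees G ↭ all-subtrees t
subtrees↭all {G = G} t eq = unique∧set⇒↭ (subtrees-unique G) (all-unique t)
  (λ Z∈ → let s = ∈-subtrees⁻ G Z∈ in
     all-complete t (isSubtree⇒isTreeGraph s) (subst (_ ⊑_) eq (subtree⊑whole s)))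
  (λ Z∈ → let tZ , Z⊑X = all-sound t Z∈ in
     ∈-subtrees⁺ G (isTreeGraph⇒isSubtree tZ
       (link-whole⁻ ∘ links⊑ (subst (_ ⊑_) (sym eq) Z⊑X))))

-- Joining a leaf u to a second neighbour v of its neighbour w

module LeafExtension {A B : Subgraph n} {u v w : Fin n} (tA : Build A w) (tB : Build B v)
         (A#B : Disjoint A B) (u∉ : u ∉ⱽ glue A w v B) where

  Y₀ U K : Subgraph n
  Y₀ = glue A w v B
  U = single u
  K = glue Y₀ w u U

  Y₀#U : Disjoint Y₀ U
  Y₀#U x∈ x∈U = u∉ (subst (_∈ⱽ Y₀) (∈-single⁻ x∈U) x∈)

  A#U : Disjoint A U
  A#U = Y₀#U ∘ glue-∈⁺ ∘ inj₁

  B#A : Disjoint B A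
  B#A = flip A#B

  tU : Build U u
  tU = singleton u

  tY : Build Y₀ w
  tY = attach tA tB A#B

  -- The tree `Y₀` rerooted at `v`, since new subtrees reach it through `v` and not through `w`.
  tY′ : Build (glue B v w A) v
  tY′ = attach tB tA B#A

  tK : Build K w
  tK = attach tY tU Y₀#U

  private
    gA = build-isTreeGraph tA
    gB = build-isTreeGraph tB
    gU = build-isTreeGraph tU
    gY = build-isTreeGraph tY
    gY′ = build-isTreeGraph tY′
    w∈A = build-root tA
    v∈B = build-root tB

  w∈Y₀ : w ∈ⱽ Y₀
  w∈Y₀ = glue-∈⁺ (inj₁ w∈A)

  v∈Y₀ : v ∈ⱽ Y₀
  v∈Y₀ = glue-∈⁺ (inj₂ v∈B)

  u≢v : u ≢ v
  u≢v refl = u∉ v∈Y₀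

  v≢w : v ≢ w
  v≢w refl = A#B w∈A v∈B

  ¬link-uv : ¬ Link K u v
  ¬link-uv e with glue-link⁻ e
  ... | inj₁ f                        = u∉ (endpoint gY f)
  ... | inj₂ (inj₁ f)                 = ¬link-single f
  ... | inj₂ (inj₂ (inj₁ (refl , _))) = u∉ w∈Y₀
  ... | inj₂ (inj₂ (inj₂ (_ , v≡w)))  = v≢w v≡w

  AU : Subgraph n
  AU = glue A w u U

  gAU : IsTreeGraph AU
  gAU = glue-isTreeGraph gA gU A#U w∈A ∈-single⁺

  AU#B : Disjoint AU B
  AU#B x∈ x∈B with glue-∈⁻ x∈
  ... | inj₁ x∈A = A#B x∈A x∈B
  ... | inj₂ x∈U = Y₀#U (glue-∈⁺ (inj₂ x∈B)) x∈U

  U#Y′ : Disjoint U (glue B v w A)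
  U#Y′ x∈U x∈ = Y₀#U (subst (_ ∈ⱽ_) glue-comm x∈) x∈U

  AU⊑K : AU ⊑ K
  AU⊑K = glue-mono glue-⊑ˡ ⊑-refl

  Y′⊑K : glue B v w A ⊑ K
  Y′⊑K = subst (_⊑ K) glue-comm glue-⊑ˡ

  Admissible : Subgraph n → Set
  Admissible Z = ∀ {x y} → Link Z x y → Link K x y ⊎ Same u v x y

  -- A new subtree is cut at the edge uv. Without the edge wu, its part at u is u alone and its part
  -- at v is any subtree of `Y₀` through v. With wu, its part at u contains w, so the part at v has
  -- to stay in `B`.
  rootedAU withoutUW withUW new : List (Subgraph n)
  rootedAU = glueAll w u (rooted tA) (rooted tU)
  withoutUW = glueAll u v (rooted tU) (rooted tY′)
  withUW = glueAll u v rootedAU (rooted tB)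
  new = withoutUW ++ withUW

  glueAU⊑ : ∀ {Z} → Z ∈ᴸ rootedAU →
            IsTreeGraph Z × Z ⊑ AU × w ∈ⱽ Z × u ∈ⱽ Z × Link Z w u
  glueAU⊑ Z∈
    with _ , _ , Z₁∈ , Z₂∈ , refl ← ∈-cartesianProductWith⁻ _ (rooted tA) (rooted tU) Z∈
    with t₁ , Z₁⊑A , w∈ ← rooted-sound tA Z₁∈ | t₂ , Z₂⊑U , u∈ ← rooted-sound tU Z₂∈ =
    glue-isTreeGraph t₁ t₂ (⊑-Disjoint Z₁⊑A Z₂⊑U A#U) w∈ u∈ , glue-mono Z₁⊑A Z₂⊑U ,
    glue-∈⁺ (inj₁ w∈) , glue-∈⁺ (inj₂ u∈) , glue-bridge

  glueAU-below : All (_⊑ AU) rootedAU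
  glueAU-below = All.tabulate (proj₁ ∘ proj₂ ∘ glueAU⊑)

  New : Subgraph n → Set
  New Z = IsTreeGraph Z × Link Z u v × Admissible Z

  glue-new : ∀ {Z W} → IsTreeGraph Z → IsTreeGraph W → Disjoint Z W → u ∈ⱽ Z → v ∈ⱽ W →
             Z ⊑ K → W ⊑ K → New (glue Z u v W)
  glue-new tZ tW Z#W u∈ v∈ Z⊑K W⊑K = glue-isTreeGraph tZ tW Z#W u∈ v∈ , glue-bridge , admissible
    where
    admissible : Admissible _
    admissible e with glue-link⁻ e
    ... | inj₁ f           = inj₁ (links⊑ Z⊑K f)
    ... | inj₂ (inj₁ f)    = inj₁ (links⊑ W⊑K f)
    ... | inj₂ (inj₂ same) = inj₂ same

  new-sound : ∀ {Z} → Z ∈ᴸ new → New Z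
  new-sound Z∈ with ∈-++⁻ withoutUW Z∈
  ... | inj₁ Z∈₁
    with _ , _ , Z₁∈ , Z₂∈ , refl ← ∈-cartesianProductWith⁻ _ (rooted tU) (rooted tY′) Z∈₁
    with t₁ , Z₁⊑ , u∈ ← rooted-sound tU Z₁∈ | t₂ , Z₂⊑ , v∈ ← rooted-sound tY′ Z₂∈ =
    glue-new t₁ t₂ (⊑-Disjoint Z₁⊑ Z₂⊑ U#Y′) u∈ v∈ (⊑-trans Z₁⊑ glue-⊑ʳ) (⊑-trans Z₂⊑ Y′⊑K)
  ... | inj₂ Z∈₂
    with _ , _ , Z₁∈ , Z₂∈ , refl ← ∈-cartesianProductWith⁻ _ rootedAU (rooted tB) Z∈₂
    with t₁ , Z₁⊑ , _ , u∈ , _ ← glueAU⊑ Z₁∈ | t₂ , Z₂⊑ , v∈ ← rooted-sound tB Z₂∈ =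
    glue-new t₁ t₂ (⊑-Disjoint Z₁⊑ Z₂⊑ AU#B) u∈ v∈ (⊑-trans Z₁⊑ AU⊑K)
      (⊑-trans Z₂⊑ (⊑-trans glue-⊑ʳ glue-⊑ˡ))

  new-complete : ∀ {Z} → (∀ {x} → x ∈ⱽ Z → x ∈ⱽ K) → New Z → Z ∈ᴸ new
  new-complete Z⊆K (tZ , e , admissible) with split-at tZ e
  ... | split {X = Z₁} {Y = Z₂} t₁ t₂ Z₁#Z₂ u∈ v∈ = found (link? Z₁ w u)
    where
    Z₁⊑K : Z₁ ⊑ K
    Z₁⊑K = (Z⊆K ∘ glue-∈⁺ ∘ inj₁) , link
      where
      link : Link Z₁ x y → Link K x y
      link f with admissible (glue-link⁺ (inj₁ f))
      ... | inj₁ k                 = k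
      ... | inj₂ (inj₁ (_ , refl)) = contradiction v∈ (Z₁#Z₂ (endpointʳ t₁ f))
      ... | inj₂ (inj₂ (refl , _)) = contradiction v∈ (Z₁#Z₂ (endpoint t₁ f))
    Z₂⊑K : Z₂ ⊑ K
    Z₂⊑K = (Z⊆K ∘ glue-∈⁺ ∘ inj₂) , link
      where
      link : Link Z₂ x y → Link K x y
      link f with admissible (glue-link⁺ (inj₂ (inj₁ f)))
      ... | inj₁ k                 = k
      ... | inj₂ (inj₁ (refl , _)) = contradiction (endpoint t₂ f) (Z₁#Z₂ u∈)
      ... | inj₂ (inj₂ (_ , refl)) = contradiction (endpointʳ t₂ f) (Z₁#Z₂ u∈)
    Z₂⊑Y : Z₂ ⊑ Y₀
    Z₂⊑Y = confined gY gU Y₀#U t₂ Z₂⊑K (Z₁#Z₂ u∈ ∘ endpointʳ t₂) v∈ v∈Y₀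
    found : Dec (Link Z₁ w u) → glue Z₁ u v Z₂ ∈ᴸ new
    found (no ¬wu) = ∈-++⁺ˡ (∈-cartesianProductWith⁺ _
      (rooted-complete tU t₁ (confinedʳ gY gU Y₀#U t₁ Z₁⊑K ¬wu u∈ ∈-single⁺) u∈)
      (rooted-complete tY′ t₂ (subst (_ ⊑_) glue-comm Z₂⊑Y) v∈))
    -- Now `w` belongs to `Z₁`, so the disjoint `Z₂` cannot use the edge between `w` and `v`.
    found (yes wu) = ∈-++⁺ʳ withoutUW (∈-cartesianProductWith⁺ _ Z₁∈
      (rooted-complete tB t₂
        (confinedʳ gA gB A#B t₂ Z₂⊑Y (Z₁#Z₂ (endpoint t₁ wu) ∘ endpoint t₂) v∈ v∈B) v∈))
      where
      cut : SplitBelow Y₀ w u U Z → (∀ {x} → x ∈ⱽ Z → x ∈ⱽ Z₁) →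
            Z ∈ᴸ rootedAU
      cut (splitBelow s₁ s₂ ⊑Y ⊑U w∈ u∈) ⊆Z₁ = ∈-cartesianProductWith⁺ _
        (rooted-complete tA s₁
          (confined gA gB A#B s₁ ⊑Y
            (λ f → Z₁#Z₂ (⊆Z₁ (glue-∈⁺ (inj₁ (endpointʳ s₁ f)))) v∈) w∈ w∈A) w∈)
        (rooted-complete tU s₂ ⊑U u∈)
      Z₁∈ : Z₁ ∈ᴸ rootedAU
      Z₁∈ = cut (split-below gY gU Y₀#U w∈Y₀ ∈-single⁺ t₁ Z₁⊑K wu) (λ x∈ → x∈)

  new-unique : Unique new
  new-unique = Unique.++⁺
    (glueAll-unique gU gY′ U#Y′ ∈-single⁺ (build-root tY′)
      (rooted-unique tU) (rooted⊑ tU) (rooted-unique tY′) (rooted⊑ tY′))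
    (glueAll-unique gAU gB AU#B (glue-∈⁺ (inj₂ ∈-single⁺)) v∈B
      (glueAll-unique gA gU A#U w∈A ∈-single⁺
        (rooted-unique tA) (rooted⊑ tA) (rooted-unique tU) (rooted⊑ tU))
      glueAU-below (rooted-unique tB) (rooted⊑ tB))
    -- The edge between `w` and `u` tells the two lists apart.
    λ (Z∈₁ , Z∈₂) → ¬link-wu Z∈₁ (link-wu Z∈₂)
    where
    link-wu : ∀ {Z} → Z ∈ᴸ withUW → Link Z w u
    link-wu Z∈
      with _ , _ , Z₁∈ , _ , refl ← ∈-cartesianProductWith⁻ _ rootedAU (rooted tB) Z∈
      with _ , _ , _ , _ , e ← glueAU⊑ Z₁∈ = glue-link⁺ (inj₁ e)
    ¬link-wu : ∀ {Z} → Z ∈ᴸ withoutUW → ¬ Link Z w u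
    ¬link-wu Z∈ e
      with _ , _ , Z₁∈ , Z₂∈ , refl ← ∈-cartesianProductWith⁻ _ (rooted tU) (rooted tY′) Z∈
      with _ , Z₁⊑U , _ ← rooted-sound tU Z₁∈ | t₂ , Z₂⊑Y′ , _ ← rooted-sound tY′ Z₂∈
      with glue-link⁻ e
    ... | inj₁ f                        = ¬link-single (links⊑ Z₁⊑U f)
    ... | inj₂ (inj₁ f)                 = U#Y′ ∈-single⁺ (vertices⊑ Z₂⊑Y′ (endpointʳ t₂ f))
    ... | inj₂ (inj₂ (inj₁ (refl , _))) = u∉ w∈Y₀
    ... | inj₂ (inj₂ (inj₂ (w≡v , _)))  = v≢w (sym w≡v)

  new-mean>rooted-mean : total (rooted tK) * length new < total new * length (rooted tK)
  new-mean>rooted-mean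
    rewrite length-++ withoutUW {withUW} | total-++ withoutUW withUW
          | length-glueAll U#Y′ (rooted⊑ tY′) {u} {v} (rooted tU)
          | total-glueAll U#Y′ (rooted⊑ tY′) {u} {v} (rooted⊑ tU)
          | length-glueAll AU#B (rooted⊑ tB) {u} {v} rootedAU
          | total-glueAll AU#B (rooted⊑ tB) {u} {v} glueAU-below
          | length-glueAll A#U (rooted⊑ tU) {w} {u} (rooted tA)
          | total-glueAll A#U (rooted⊑ tU) {w} {u} (rooted⊑ tA)
          | length-rooted tY tU Y₀#U | total-rooted tY tU Y₀#U
          | length-rooted tA tB A#B | total-rooted tA tB A#B
          | length-rooted tB tA B#A | total-rooted tB tA B#A
          | total-rooted-singleton u =
    extension-inequality (total (rooted tA)) (total (rooted tB))
      (1≤length-rooted tA) (1≤length-rooted tB) (total≤length²-rooted tA)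

  -- The edge between `u` and `v` separates the two lists; a subtree of the joined graph without it
  -- has all its links in `K`.
  subtrees-join↭ : {G : Graph n} → whole G ≡ K → subtrees (join G u≢v) ↭ all-subtrees tK ++ new
  subtrees-join↭ {G} eq = unique∧set⇒↭ (subtrees-unique (join G u≢v))
    (Unique.++⁺ (all-unique tK) new-unique
      λ (Z∈₁ , Z∈₂) → ¬link-uv
        (links⊑ (proj₂ (all-sound tK Z∈₁)) (proj₁ (proj₂ (new-sound Z∈₂)))))
    to from
    where
    to : ∀ {Z} → Z ∈ᴸ subtrees (join G u≢v) → Z ∈ᴸ all-subtrees tK ++ new
    to {Z} Z∈ = by-link (link? Z u v)
      where
      s = ∈-subtrees⁻ (join G u≢v) Z∈
      tZ = isSubtree⇒isTreeGraph s
      link : Link Z x y → Link K x y ⊎ Same u v x y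
      link e = Sum.map₁ (subst (λ X → Link X _ _) eq) (subtree-join⁻ u≢v s e)
      ⊆K : ∀ {x} → x ∈ⱽ Z → x ∈ⱽ K
      ⊆K _ = subst (_ ∈ⱽ_) eq ∈-whole
      by-link : Dec (Link Z u v) → Z ∈ᴸ all-subtrees tK ++ new
      by-link (yes e) = ∈-++⁺ʳ (all-subtrees tK) (new-complete ⊆K (tZ , e , link))
      by-link (no ¬e) = ∈-++⁺ˡ (all-complete tK tZ (⊆K , link-K))
        where
        link-K : Link Z x y → Link K x y
        link-K f with link f
        ... | inj₁ k = k
        ... | inj₂ (inj₁ (refl , refl)) = contradiction f ¬e
        ... | inj₂ (inj₂ (refl , refl)) = contradiction (symmetric tZ f) ¬e
    from : ∀ {Z} → Z ∈ᴸ all-subtrees tK ++ new → Z ∈ᴸ subtrees (join G u≢v)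
    from Z∈ = ∈-subtrees⁺ (join G u≢v) (is-subtree (∈-++⁻ (all-subtrees tK) Z∈))
      where
      back : Link K x y → Link (whole G) x y
      back = subst (λ X → Link X _ _) (sym eq)
      is-subtree : ∀ {Z} → Z ∈ᴸ all-subtrees tK ⊎ Z ∈ᴸ new → IsSubtree (join G u≢v) Z
      is-subtree (inj₁ Z∈) = let tZ , Z⊑K = all-sound tK Z∈ in
        subtree-join⁺ u≢v tZ (inj₁ ∘ back ∘ links⊑ Z⊑K)
      is-subtree (inj₂ Z∈) = let tZ , _ , admissible = new-sound Z∈ in
        subtree-join⁺ u≢v tZ (Sum.map₁ back ∘ admissible)

  μ-increases : {G : Graph n} .{{_ : NonZero n}} → whole G ≡ K → μ (join G u≢v) > μ G
  μ-increases {G} eq = μ-< G (join G u≢v) (subtrees↭all tK eq) (subtrees-join↭ eq) increase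
    where
    increase : total (all-subtrees tK) * length (all-subtrees tK ++ new) <
               total (all-subtrees tK ++ new) * length (all-subtrees tK)
    increase rewrite length-++ (all-subtrees tK) {new} | total-++ (all-subtrees tK) new =
      mean-increases {M = total (all-subtrees tK)} {D = total (rooted tK)} {F = length (rooted tK)}
        {M′ = total new} {N′ = length new}
        (≤-trans (1≤length-rooted tK)
          (subst (length (rooted tK) ≤_) (sym (length-++ (rooted tK))) (m≤m+n _ _)))
        (mean≤rooted-mean tK) new-mean>rooted-mean

-- Cutting off a leaf and choosing a second neighbour

leaf-split : IsTreeGraph X → IsLeaf X u w →
             ∃ λ Y → X ≡ glue Y w u (single u) × IsTreeGraph Y × w ∈ⱽ Y × u ∉ⱽ Y
leaf-split tX (e , leaf) with split-at tX e
... | split {Y = Z} tY tZ Y#Z w∈ u∈ = _ ,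
  cong (glue _ _ _) (isolated⇒single tZ u∈ isolated) , tY , w∈ , λ u∈Y → Y#Z u∈Y u∈
  where
  isolated : ¬ Link Z _ x
  isolated f with refl ← leaf (glue-link⁺ (inj₂ (inj₁ f))) = Y#Z w∈ (endpointʳ tZ f)

data LeafDecomposition {n} : Subgraph n → Set where
  decompose : ∀ {A B : Subgraph n} {u v w} → Build A w → Build B v → Disjoint A B →
              u ∉ⱽ glue A w v B → LeafDecomposition (glue (glue A w v B) w u (single u))

-- Order at least two after removal of the leaf is what gives `w` another neighbour `v`; this is the
-- use of order at least three in the theorem.
attach-leaf : IsTreeGraph Y → 2 ≤ order Y → w ∈ⱽ Y → u ∉ⱽ Y →
              LeafDecomposition (glue Y w u (single u))
attach-leaf {Y = Y} {w = w} tY 2≤ w∈ u∉ with any? (link? Y w)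
... | no isolated = contradiction
        (subst (2 ≤_) (trans (cong order (isolated⇒single tY w∈ λ e → isolated (_ , e)))
                             (order-single w)) 2≤)
        λ { (s≤s ()) }
... | yes (v , e) with split-at tY e
...   | split tA tB A#B w∈A v∈B = decompose (build tA w∈A) (build tB v∈B) A#B u∉

leaf-decomposition : IsTreeGraph X → 3 ≤ order X → LeafDecomposition X
leaf-decomposition tX 3≤ with find-leaf (build tX (root∈ tX))
... | inj₁ X≡single =
  contradiction (subst (3 ≤_) (trans (cong order X≡single) (order-single _)) 3≤) λ { (s≤s ()) }
... | inj₂ (u , w , _ , leaf) with leaf-split tX leaf
...   | Y , refl , tY , w∈ , u∉ = attach-leaf tY 2≤ w∈ u∉
  where
  Y#u : Disjoint Y (single u)
  Y#u x∈ x∈u = u∉ (subst (_∈ⱽ Y) (∈-single⁻ x∈u) x∈)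
  2≤ : 2 ≤ order Y
  2≤ = +-cancelʳ-≤ 1 2 (order Y)
    (subst (3 ≤_) (trans (order-glue Y#u) (cong (order Y +_) (order-single u))) 3≤)

theorem4p1 : ∀ (n : ℕ) .{{_ : NonZero n}} → n ≥ 3 →
    (T : Graph n) → Tree T →
    ∃₂ λ u v → Σ (u ≢ v) λ u≢v →
    ¬ (u ~[ T ] v) × μ (join T u≢v) > μ T
theorem4p1 n n≥3 T tT = extend refl
  (leaf-decomposition (whole-isTreeGraph tT) (subst (3 ≤_) (sym (order-whole T)) n≥3))
  where
  -- `whole T` is not a variable, so the decomposition is matched at a general index that an
  -- equation ties to it.
  extend : ∀ {X} → whole T ≡ X → LeafDecomposition X →
           ∃₂ λ u v → Σ (u ≢ v) λ u≢v → ¬ (u ~[ T ] v) × μ (join T u≢v) > μ T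
  extend eq (decompose {u = u} {v} tA tB A#B u∉) =
    u , v , u≢v , (¬link-uv ∘ subst (λ X → Link X u v) eq ∘ link-whole⁺) , μ-increases eq
    where open LeafExtension tA tB A#B u∉
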